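{- Let $G$ be a graph with no isolated vertices, and suppose $G$ has a chain decomposition rooted at some $r\in V(G)$. Then there exists a set of four spanning trees of $G$ that are pairwise edge-independent with root $r$.
   Context: Graphs are multigraphs (parallel edges and loops allowed; a loop adds $2$ to the degree; a loop is a cycle of length one and two parallel edges form a cycle of length two). Paths and cycles are simple. The degree of a vertex in a subgraph not containing it is $0$. An up chain of $G$ with respect to a pair of edge-disjoint subgraphs $(H,\overline{H})$ is a subgraph of $G$, edge-disjoint from $H$ and $\overline{H}$, which is either (i) a path with at least one edge such that every vertex is either $r$ or has degree at least two in $\overline{H}$, and each end is either $r$ or lies in $H$; or (ii) a cycle such that every vertex is either $r$ or has degree at least two in $\overline{H}$, and some vertex $v$ of it is either $r$ or has degree at least two in $H$ ($v$ is regarded as both ends, all other vertices internal). A down chain with respect to $(H,\overline{H})$ is an up chain with respect to $(\overline{H},H)$. A one-way chain with respect to $(H,\overline{H})$ is the subgraph induced by a single edge $e\notin E(H)\cup E(\overline{H})$ with ends $u$ (tail) and $v$ (head) such that $u$ is $r$ or has degree at least two in $H$, and $v$ is $r$ or has degree at least two in $\overline{H}$. A sequence $G_0,\dots,G_m$ of subgraphs of $G$ is a chain decomposition of $G$ rooted at $r$ if, writing $H_i=G_0\cup\cdots\cup G_{i-1}$ and $\overline{H_i}=G_{i+1}\cup\cdots\cup G_m$ (so $H_0$ and $\overline{H_m}$ are null), the sets $E(G_0),\dots,E(G_m)$ partition $E(G)$ and each $G_i$ is an up chain, a down chain, or a one-way chain with respect to $(H_i,\overline{H_i})$. Two subtrees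 $T_1,T_2$ of $G$ are edge-independent with root $r$ if both contain $r$ and for every $v\in V(T_1)\cap V(T_2)$ the unique $r$–$v$ paths in $T_1$ and $T_2$ are edge-disjoint. -}

module Defs where

open import Data.Nat using (ℕ; zero; suc; _+_; _≤_; _<ᵇ_)
open import Data.Fin using (Fin; zero; suc; toℕ; fromℕ; inject₁; _≟_)
open import Data.Product using (Σ; Σ-syntax; ∃; ∃-syntax; _×_; _,_; proj₁; proj₂)
open import Data.Sum using (_⊎_)
open import Data.Bool using (Bool; true; false; if_then_else_)
open import Data.List using (List; map; allFin)
open import Data.Nat.ListAction using (sum)
open import Relation.Binary.PropositionalEquality using (_≡_; _≢_)
open import Relation.Nullary using (¬_)
open import Relation.Nullary.Decidable using (⌊_⌋)
open import Function.Definitions using (Injective)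
open import Function.Bundles using (_⇔_)

-- A finite multigraph with vertex set Fin n and edge set Fin m; edge e has
-- ends  ends e = (x , y)  (x ≡ y means a loop; parallel edges allowed).
module _ {n m : ℕ} (ends : Fin m → Fin n × Fin n) where

  Joins : Fin m → Fin n → Fin n → Set
  Joins e u v = ends e ≡ (u , v) ⊎ ends e ≡ (v , u)

  IncidentTo : Fin m → Fin n → Set
  IncidentTo e v = proj₁ (ends e) ≡ v ⊎ proj₂ (ends e) ≡ v

  NoIsolatedVertices : Set
  NoIsolatedVertices = ∀ v → ∃[ e ] IncidentTo e v

  endCount : Fin m → Fin n → ℕ
  endCount e v = (if ⌊ proj₁ (ends e) ≟ v ⌋ then 1 else 0)
               + (if ⌊ proj₂ (ends e) ≟ v ⌋ then 1 else 0)

  -- degree of v in the subgraph with edge set S (0 if v is not in it)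
  deg : (Fin m → Bool) → Fin n → ℕ
  deg S v = sum (map (λ e → if S e then endCount e v else 0) (allFin m))

  -- v is a vertex of the subgraph (a union of chains) with edge set S;
  -- such subgraphs have no isolated vertices, so this means: incident to an edge of S
  InSub : (Fin m → Bool) → Fin n → Set
  InSub S v = ∃[ e ] (S e ≡ true × IncidentTo e v)

  record Path (u v : Fin n) : Set where
    field
      len    : ℕ
      vert   : Fin (suc len) → Fin n
      edge   : Fin len → Fin m
      start  : vert zero ≡ u
      finish : vert (fromℕ len) ≡ v
      vinj   : Injective _≡_ _≡_ vert
      step   : ∀ i → Joins (edge i) (vert (inject₁ i)) (vert (suc i))

  -- cycle of length suc len (length 1 = loop, length 2 = two parallel edges)
  record Cycle : Set where
    field
      len   : ℕ
      vert  : Fin (suc len) → Fin n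
      edge  : Fin (suc len) → Fin m
      vinj  : Injective _≡_ _≡_ vert
      einj  : Injective _≡_ _≡_ edge
      step  : ∀ (i : Fin len) → Joins (edge (inject₁ i)) (vert (inject₁ i)) (vert (suc i))
      close : Joins (edge (fromℕ len)) (vert (fromℕ len)) (vert zero)

  module _ (r : Fin n) where

    RootOrDeg2 : (Fin m → Bool) → Fin n → Set
    RootOrDeg2 S v = v ≡ r ⊎ 2 ≤ deg S v

    UpChain : (H Hb : Fin m → Bool) → (X : Fin m → Set) → Set
    UpChain H Hb X =
        (Σ[ u ∈ Fin n ] Σ[ v ∈ Fin n ] Σ[ P ∈ Path u v ]
             (1 ≤ Path.len P)
           × (∀ e → X e ⇔ (∃[ j ] Path.edge P j ≡ e))
           × (∀ j → RootOrDeg2 Hb (Path.vert P j))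
           × (u ≡ r ⊎ InSub H u)
           × (v ≡ r ⊎ InSub H v))
      ⊎ (Σ[ C ∈ Cycle ]
             (∀ e → X e ⇔ (∃[ j ] Cycle.edge C j ≡ e))
           × (∀ j → RootOrDeg2 Hb (Cycle.vert C j))
           × (∃[ j ] RootOrDeg2 H (Cycle.vert C j)))

    DownChain : (H Hb : Fin m → Bool) → (X : Fin m → Set) → Set
    DownChain H Hb X = UpChain Hb H X

    -- one-way chain: a single edge e with tail u and head v
    OneWayChain : (H Hb : Fin m → Bool) → (X : Fin m → Set) → Set
    OneWayChain H Hb X =
      Σ[ e ∈ Fin m ] Σ[ u ∈ Fin n ] Σ[ v ∈ Fin n ]
          (∀ f → X f ⇔ f ≡ e)
        × Joins e u v
        × RootOrDeg2 H u
        × RootOrDeg2 Hb v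

    -- chain decomposition G_0 , … , G_k : edge e belongs to G_(c e)
    record ChainDecomposition : Set where
      field
        k : ℕ
        c : Fin m → Fin (suc k)
      Hlow : Fin (suc k) → Fin m → Bool
      Hlow i e = toℕ (c e) <ᵇ toℕ i
      Hhigh : Fin (suc k) → Fin m → Bool
      Hhigh i e = toℕ i <ᵇ toℕ (c e)
      Gi : Fin (suc k) → Fin m → Set
      Gi i e = c e ≡ i
      field
        isChain : ∀ i → UpChain (Hlow i) (Hhigh i) (Gi i)
                      ⊎ DownChain (Hlow i) (Hhigh i) (Gi i)
                      ⊎ OneWayChain (Hlow i) (Hhigh i) (Gi i)

    SpanningTree : (Fin m → Bool) → Set
    SpanningTree T =
        (∀ v → Σ[ P ∈ Path r v ] (∀ i → T (Path.edge P i) ≡ true))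
      × ¬ (Σ[ C ∈ Cycle ] (∀ i → T (Cycle.edge C i) ≡ true))

    EdgeIndependent : (T₁ T₂ : Fin m → Bool) → Set
    EdgeIndependent T₁ T₂ =
      ∀ v (P₁ : Path r v) (P₂ : Path r v)
        → (∀ i → T₁ (Path.edge P₁ i) ≡ true)
        → (∀ i → T₂ (Path.edge P₂ i) ≡ true)
        → ∀ i j → Path.edge P₁ i ≢ Path.edge P₂ j

module Submission where

-- Read the chains in order, and give every vertex v ≠ r two parent edges lo v and hi v among the first
-- chains that reach it (up chains, or one-way chains with head v), together with a rank on edges such that
-- rank (lo v) < rank (hi v), lo-parents strictly decrease along lo and hi-parents strictly increase along hi.
-- An up chain splits at its already reached vertices into ears; an ear from u to v gets ranks increasing
-- from lo u to hi v, or decreasing from hi u to lo v, and one of the two is always possible.  The lo and hi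
-- trees are edge-independent because the r–v path of the first uses ranks ≤ rank (lo v) and that of the
-- second ranks ≥ rank (hi v).  Reversing the decomposition gives two more trees.  Some chain index i
-- separates the two pairs at v: v has degree two both in the chains up to i and in those after i, so the
-- r–v paths of the first pair stay in chains ≤ i and those of the second pair in chains > i.

-- The two trees of a pair may share edges: an edge between two inner vertices of an ear is the
-- `lo`-parent edge of one and the `hi`-parent edge of the other. Only the two paths to one vertex
-- must be disjoint, and the ranks certify exactly that. Ears are inserted into gaps between ranks
-- already in use, so ranks are rationals and no old rank ever moves. The obstacle is the head of a
-- one-way chain, which gains one edge but needs two parents. It waits, its edge ranked strictly
-- between the two parent ranks of the tail, until a second edge reaches it; only then is it decided
-- which of the two trees the waiting edge serves. Down chains attach nothing in this direction,
-- because each of their vertices is `r` or has both parents by then. In the reversed decomposition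
-- they are the up chains.

open import Defs
open import Data.Bool using (Bool; true; false; if_then_else_)
open import Data.Bool.Properties using (T-≡)
open import Data.Empty using (⊥-elim)
open import Data.Fin using (Fin; zero; suc; toℕ; fromℕ; fromℕ<; inject₁; _≟_)
open import Data.Fin.Induction using (spo-wellFounded; <-weakInduction; >-weakInduction)
open import Data.Fin.Properties
  using (any?; fromℕ≢inject₁; inject₁-injective; suc-injective; toℕ-inject₁; toℕ-injective; toℕ-fromℕ; toℕ-fromℕ<; toℕ<n)
open import Data.Fin.Relation.Unary.Top using (view; view-fromℕ; view-inject₁; ‵fromℕ; ‵inject₁)
open import Data.List using (List; []; _∷_; _++_; map; _∷ʳ_; allFin; tabulate)
open import Data.List.Membership.Propositional using (_∈_; _∉_)
open import Data.List.Membership.Propositional.Properties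
  using (∈-++⁺ˡ; ∈-++⁺ʳ; ∈-++⁻; ∈-tabulate⁺; ∈-tabulate⁻)
open import Data.List.Properties using (∷ʳ-++; map-++; map-tabulate)
open import Data.List.Relation.Unary.All using (All; []; _∷_)
import Data.List.Relation.Unary.All as All
import Data.List.Relation.Unary.All.Properties as All
open import Data.List.Relation.Unary.AllPairs using ([]; _∷_)
import Data.List.Relation.Unary.AllPairs as AllPairs
open import Data.List.Relation.Unary.Any using (here; there)
open import Data.List.Relation.Unary.Unique.Propositional using (Unique)
open import Data.List.Relation.Unary.Unique.Propositional.Properties using (tabulate⁺; allFin⁺; ++⁺)
open import Data.Maybe using (Maybe; just; nothing; maybe′)
import Data.Maybe as Maybe
import Data.Maybe.Properties as Maybe
open import Data.Nat using (ℕ; zero; suc; _<_; _≤_; s≤s; z≤n)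
import Data.Nat as ℕ
open import Data.Nat.ListAction using (sum)
import Data.Nat.Properties as ℕ
open import Data.Product using (Σ-syntax; ∃-syntax; ∃₂; _×_; _,_; proj₁; proj₂)
import Data.Product.Properties as Prod
open import Data.Rational using (ℚ; 0ℚ; 1ℚ)
import Data.Rational as ℚ
import Data.Rational.Properties as ℚ
open import Data.Sum using (_⊎_; inj₁; inj₂)
import Data.Sum as Sum
open import Data.Unit using (⊤; tt)
open import Function.Base using (_∘_; id)
open import Function.Bundles using (Equivalence)
open import Function.Definitions using (Injective)
import Induction.WellFounded as WF
open import Relation.Binary.Definitions using (tri<; tri≈; tri>)
open import Relation.Binary.PropositionalEquality
open import Relation.Binary.Structures using (IsStrictPartialOrder)
open import Relation.Nullary using (¬_; Dec; yes; no; does; contradiction)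
open import Relation.Nullary.Decidable using (dec-true; toWitness; _×-dec_; _⊎-dec_; ¬?)

-- Trees given by a parent function

module _ {n m : ℕ} {ends : Fin m → Fin n × Fin n} where

  joins-sym : ∀ {e u v} → Joins ends e u v → Joins ends e v u
  joins-sym (inj₁ eq) = inj₂ eq
  joins-sym (inj₂ eq) = inj₁ eq

  joins-cases : ∀ {e u v x y} → Joins ends e u v → Joins ends e x y →
                (u ≡ x × v ≡ y) ⊎ (u ≡ y × v ≡ x)
  joins-cases (inj₁ p) (inj₁ q) with refl ← trans (sym p) q = inj₁ (refl , refl)
  joins-cases (inj₁ p) (inj₂ q) with refl ← trans (sym p) q = inj₂ (refl , refl)
  joins-cases (inj₂ p) (inj₁ q) with refl ← trans (sym p) q = inj₂ (refl , refl)
  joins-cases (inj₂ p) (inj₂ q) with refl ← trans (sym p) q = inj₁ (refl , refl)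

snoc : ∀ {A : Set} {k} → (Fin k → A) → A → Fin (suc k) → A
snoc f x i with view i
... | ‵fromℕ     = x
... | ‵inject₁ j = f j

snoc-inject₁ : ∀ {A : Set} {k} (f : Fin k → A) x j → snoc f x (inject₁ j) ≡ f j
snoc-inject₁ f x j rewrite view-inject₁ j = refl

snoc-fromℕ : ∀ {A : Set} {k} (f : Fin k → A) x → snoc f x (fromℕ k) ≡ x
snoc-fromℕ {k = k} f x rewrite view-fromℕ k = refl

snoc-elim : ∀ {A : Set} {k} (f : Fin k → A) x (P : A → Set) →
            (∀ j → P (f j)) → P x → ∀ i → P (snoc f x i)
snoc-elim f x P Pf Px i with view i
... | ‵fromℕ     = Px
... | ‵inject₁ j = Pf j

module Tree {n m : ℕ} (ends : Fin m → Fin n × Fin n) (r : Fin n)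
  (parent : Fin n → Maybe (Fin m × Fin n))
  (_⊏_ : Fin n → Fin n → Set) (⊏-spo : IsStrictPartialOrder _≡_ _⊏_)
  (root : parent r ≡ nothing)
  (total : ∀ v → v ≢ r → ∃[ x ] parent v ≡ just x)
  (joins : ∀ {v e u} → parent v ≡ just (e , u) → Joins ends e v u)
  (descends : ∀ {v e u} → parent v ≡ just (e , u) → u ⊏ v) where

  private
    module O = IsStrictPartialOrder ⊏-spo

    used? : ∀ e → Dec (∃[ v ] Maybe.map proj₁ (parent v) ≡ just e)
    used? e = any? λ v → Maybe.≡-dec _≟_ (Maybe.map proj₁ (parent v)) (just e)

    parent-det : ∀ {v e f u w} → parent v ≡ just (e , u) → parent v ≡ just (f , w) → e ≡ f × u ≡ w
    parent-det p q with refl ← trans (sym p) q = refl , refl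

  tree : Fin m → Bool
  tree e = does (used? e)

  tree-complete : ∀ {v e u} → parent v ≡ just (e , u) → tree e ≡ true
  tree-complete {v} {e} p = dec-true (used? e) (v , cong (Maybe.map proj₁) p)

  tree-sound : ∀ {e} → tree e ≡ true → ∃[ v ] ∃[ u ] parent v ≡ just (e , u)
  tree-sound {e} t with used? e
  ... | yes (v , p) with just (e' , u) ← parent v in eq | refl ← p = v , u , eq
  tree-sound {e} () | no _

  orient : ∀ {e x y} → tree e ≡ true → Joins ends e x y →
           parent x ≡ just (e , y) ⊎ parent y ≡ just (e , x)
  orient t j with v , u , p ← tree-sound t with joins-cases {ends = ends} (joins p) j
  ... | inj₁ (refl , refl) = inj₁ p
  ... | inj₂ (refl , refl) = inj₂ p

  private
    record PathTo (v : Fin n) : Set where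
      field
        path  : Path ends r v
        above : ∀ i → Path.vert path i ≡ v ⊎ Path.vert path i ⊏ v
        inT   : ∀ i → tree (Path.edge path i) ≡ true

    nil-path : PathTo r
    nil-path = record
      { path = record { len = 0 ; vert = λ _ → r ; edge = λ () ; start = refl ; finish = refl
                      ; vinj = λ { {zero} {zero} _ → refl } ; step = λ () }
      ; above = λ _ → inj₁ refl ; inT = λ () }

    snoc-path : ∀ {v e u} → parent v ≡ just (e , u) → PathTo u → PathTo v
    snoc-path {v} {e} {u} p Q = record
      { path = record
        { len = suc len ; vert = vert′ ; edge = snoc edge e
        ; start = trans (snoc-inject₁ vert v zero) start ; finish = snoc-fromℕ vert v
        ; vinj = vinj′ _ _ ; step = step′ }
      ; above = snoc-elim vert v (λ w → w ≡ v ⊎ w ⊏ v) (inj₂ ∘ below) (inj₁ refl)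
      ; inT = snoc-elim edge e (λ f → tree f ≡ true) (PathTo.inT Q) (tree-complete p) }
      where
      open Path (PathTo.path Q)
      vert′ = snoc vert v
      below : ∀ i → vert i ⊏ v
      below i with PathTo.above Q i
      ... | inj₁ eq  = subst (_⊏ v) (sym eq) (descends p)
      ... | inj₂ lt = O.trans lt (descends p)
      vinj′ : ∀ i j → vert′ i ≡ vert′ j → i ≡ j
      vinj′ i j eq with view i | view j
      ... | ‵fromℕ     | ‵fromℕ     = refl
      ... | ‵fromℕ     | ‵inject₁ b = ⊥-elim (O.irrefl (sym eq) (below b))
      ... | ‵inject₁ a | ‵fromℕ     = ⊥-elim (O.irrefl eq (below a))
      ... | ‵inject₁ a | ‵inject₁ b = cong inject₁ (vinj eq)
      step′ : ∀ i → Joins ends (snoc edge e i) (vert′ (inject₁ i)) (vert′ (suc i))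
      step′ i with view i
      ... | ‵fromℕ rewrite snoc-inject₁ vert v (fromℕ len) | finish = joins-sym {ends = ends} (joins p)
      ... | ‵inject₁ j rewrite snoc-inject₁ vert v (inject₁ j) = step j

    path-to : ∀ v → WF.Acc _⊏_ v → PathTo v
    path-to v (WF.acc rs) with v ≟ r
    ... | yes refl = nil-path
    ... | no v≢r with (e , u) , p ← total v v≢r = snoc-path p (path-to u (rs (descends p)))

    -- Every edge of the cycle is the parent edge of one of its ends.  Whichever end it is for the closing
    -- edge, the choice propagates around the cycle, so _⊏_ would be monotone along it.
    no-cycle : ¬ (Σ[ C ∈ Cycle ends ] (∀ i → tree (Cycle.edge C i) ≡ true))
    no-cycle (C , inT) with orient (inT (fromℕ (Cycle.len C))) (Cycle.close C)
    ... | inj₁ p = O.irrefl refl (first-above zero)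
      where
      open Cycle C
      first-above : ∀ i → vert zero ⊏ vert i
      parent-next : ∀ i → ∃[ u ] parent (vert i) ≡ just (edge i , u) × (vert zero ⊏ vert i)
      parent-next = >-weakInduction _ (vert zero , p , descends p) go
        where
        go : ∀ (i : Fin len) → ∃[ u ] parent (vert (suc i)) ≡ just (edge (suc i) , u) × (vert zero ⊏ vert (suc i)) →
             ∃[ u ] parent (vert (inject₁ i)) ≡ just (edge (inject₁ i) , u) × (vert zero ⊏ vert (inject₁ i))
        go i (u , q , lt) with orient (inT (inject₁ i)) (step i)
        ... | inj₁ q′ = _ , q′ , O.trans lt (descends q′)
        ... | inj₂ q′ with () ← ℕ.1+n≢n (trans (cong toℕ (einj (proj₁ (parent-det q q′)))) (toℕ-inject₁ i))
      first-above i = proj₂ (proj₂ (parent-next i))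
    ... | inj₂ p = ends-apart (ascend (fromℕ len))
      where
      open Cycle C
      ends-apart : ¬ (vert zero ≡ vert (fromℕ len) ⊎ vert zero ⊏ vert (fromℕ len))
      ends-apart (inj₁ eq) = O.irrefl (sym eq) (descends p)
      ends-apart (inj₂ lt) = O.irrefl refl (O.trans lt (descends p))
      -- Carried along: the parent edge of `vert i` is none of the edges still ahead (at the start
      -- it is the closing edge), so the next edge must be the parent edge of the next vertex.
      Rising : Fin (suc len) → Set
      Rising i = (∀ (j : Fin len) u → toℕ i ℕ.≤ toℕ j → parent (vert i) ≢ just (edge (inject₁ j) , u))
               × (vert zero ≡ vert i ⊎ vert zero ⊏ vert i)
      rise : ∀ i → Rising (inject₁ i) → Rising (suc i)
      rise i (new , le) with orient (inT (inject₁ i)) (step i)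
      ... | inj₁ q = ⊥-elim (new i _ (ℕ.≤-reflexive (toℕ-inject₁ i)) q)
      ... | inj₂ q = (λ j u i<j q′ → ℕ.<-irrefl (cong toℕ (inject₁-injective (einj (proj₁ (parent-det q q′))))) i<j)
                   , inj₂ (below le)
        where
        below : (vert zero ≡ vert (inject₁ i) ⊎ vert zero ⊏ vert (inject₁ i)) → vert zero ⊏ vert (suc i)
        below (inj₁ eq) = subst (_⊏ vert (suc i)) (sym eq) (descends q)
        below (inj₂ lt) = O.trans lt (descends q)
      ascend : ∀ i → vert zero ≡ vert i ⊎ vert zero ⊏ vert i
      ascend i = proj₂ (<-weakInduction Rising
        ((λ j u _ q → fromℕ≢inject₁ (einj (proj₁ (parent-det p q)))) , inj₁ refl) rise i)

  spanning : SpanningTree ends r tree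
  spanning = (λ v → let Q = path-to v (spo-wellFounded ⊏-spo v) in PathTo.path Q , PathTo.inT Q) , no-cycle

  data Ancestral : Fin n → Fin m → Set where
    here  : ∀ {v e u} → parent v ≡ just (e , u) → Ancestral v e
    there : ∀ {v f u e} → parent v ≡ just (f , u) → Ancestral u e → Ancestral v e

  -- Since `r` has no parent, a simple tree path out of `r` always goes from parent to child: if an
  -- edge were the parent edge of its earlier end, the next vertex would already lie on the path.
  -- Edge-independence, stated for arbitrary tree paths, thus reduces to ancestor edges.
  path-ancestral : ∀ {v} (P : Path ends r v) → (∀ i → tree (Path.edge P i) ≡ true) →
                   ∀ i → Ancestral v (Path.edge P i)
  path-ancestral {v} P inT = λ i → subst (λ w → Ancestral w (edge i)) finish (upto i)
    where
    open Path P
    BackwardParent : Fin (suc len) → Set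
    BackwardParent i = ∀ {f w} → parent (vert i) ≡ just (f , w) → ∃[ j ] w ≡ vert j × toℕ j ℕ.≤ toℕ i
    child-of : ∀ i → BackwardParent (inject₁ i) → parent (vert (suc i)) ≡ just (edge i , vert (inject₁ i))
    child-of i back with orient (inT i) (step i)
    ... | inj₂ p = p
    ... | inj₁ p with j , eq , j≤i ← back p =
      ⊥-elim (ℕ.<-irrefl (cong toℕ (sym (vinj eq))) (ℕ.s≤s (ℕ.≤-trans j≤i (ℕ.≤-reflexive (toℕ-inject₁ i)))))
    backward : ∀ i → BackwardParent i
    backward = <-weakInduction BackwardParent
      (λ p → ⊥-elim (just≢nothing (trans (sym p) (subst (λ w → parent w ≡ nothing) (sym start) root))))
      (λ i back p → inject₁ i , proj₂ (parent-det p (child-of i back)) ,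
                    ℕ.≤-trans (ℕ.≤-reflexive (toℕ-inject₁ i)) (ℕ.n≤1+n _))
      where
      just≢nothing : ∀ {x : Fin m × Fin n} → just x ≢ nothing
      just≢nothing ()
    child : ∀ i → parent (vert (suc i)) ≡ just (edge i , vert (inject₁ i))
    child i = child-of i (backward (inject₁ i))
    before : ∀ k (i : Fin len) → toℕ i ℕ.< toℕ k → Ancestral (vert k) (edge i)
    before = <-weakInduction _ (λ i ()) go
      where
      go : ∀ k → (∀ (i : Fin len) → toℕ i ℕ.< toℕ (inject₁ k) → Ancestral (vert (inject₁ k)) (edge i)) →
           ∀ (i : Fin len) → toℕ i ℕ.< suc (toℕ k) → Ancestral (vert (suc k)) (edge i)
      go k ih i i<1+k with i ≟ k
      ... | yes refl = here (child k)
      ... | no i≢k = there (child k) (ih i (subst (toℕ i ℕ.<_) (sym (toℕ-inject₁ k))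
                       (ℕ.≤∧≢⇒< (ℕ.s≤s⁻¹ i<1+k) (i≢k ∘ toℕ-injective))))
    upto : ∀ i → Ancestral (vert (fromℕ len)) (edge i)
    upto i = before (fromℕ len) i (subst (toℕ i ℕ.<_) (sym (toℕ-fromℕ len)) (toℕ<n i))

-- Ranks and chains

Unique-++⁻ : ∀ {A : Set} (xs : List A) {ys} → Unique (xs ++ ys) →
             Unique xs × Unique ys × (∀ {x} → x ∈ xs → x ∉ ys)
Unique-++⁻ [] u = [] , u , λ ()
Unique-++⁻ (x ∷ xs) (x∉ ∷ u) with ux , uy , disj ← Unique-++⁻ xs u =
  All.++⁻ˡ xs x∉ ∷ ux , uy ,
  λ { (here refl) y∈ → All.lookup (All.++⁻ʳ xs x∉) y∈ refl ; (there x∈) → disj x∈ }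

data Side : Set where
  lo hi : Side

data Opp : Side → Side → Set where
  lohi : Opp lo hi
  hilo : Opp hi lo

opp-sym : ∀ {σ τ} → Opp σ τ → Opp τ σ
opp-sym lohi = hilo
opp-sym hilo = lohi

-- A datatype rather than a function of the side, so that the ranks can be inferred from it.
data _<[_]_ (a : ℚ) : Side → ℚ → Set where
  up   : ∀ {b} → a ℚ.< b → a <[ lo ] b
  down : ∀ {b} → b ℚ.< a → a <[ hi ] b

<-flip : ∀ {σ τ a b} → Opp σ τ → a <[ σ ] b → b <[ τ ] a
<-flip lohi (up p)   = down p
<-flip hilo (down p) = up p

<σ-irrefl : ∀ {σ a b} → a ≡ b → ¬ (a <[ σ ] b)
<σ-irrefl refl (up p)   = ℚ.<-irrefl refl p
<σ-irrefl refl (down p) = ℚ.<-irrefl refl p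

<σ-dense : ∀ {σ a b} → a <[ σ ] b → ∃[ q ] a <[ σ ] q × q <[ σ ] b
<σ-dense (up p)   with q , l , u ← ℚ.<-dense p = q , up l , up u
<σ-dense (down p) with q , l , u ← ℚ.<-dense p = q , down u , down l

<σ-connex : ∀ a b → a ≢ b → ∃₂ λ σ τ → Opp σ τ × a <[ σ ] b
<σ-connex a b a≢b with ℚ.<-cmp a b
... | tri< p _ _ = lo , hi , lohi , up p
... | tri≈ _ p _ = ⊥-elim (a≢b p)
... | tri> _ _ p = hi , lo , hilo , down p

-- Cut the interval at an inner point and keep the part that misses `f zero`. The rank of a waiting
-- edge is chosen this way, so that two pending vertices can always be compared.
between-avoiding : ∀ {k} (f : Fin k → ℚ) {a b} → a ℚ.< b → ∃[ q ] a ℚ.< q × q ℚ.< b × (∀ j → f j ≢ q)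
between-avoiding {zero} f p with q , l , u ← ℚ.<-dense p = q , l , u , λ ()
between-avoiding {suc k} f p with x , l , u ← ℚ.<-dense p with f zero ℚ.<? x
... | yes f<x with q , l′ , u′ , avoid ← between-avoiding (f ∘ suc) u =
  q , ℚ.<-trans l l′ , u′ , λ { zero refl → ℚ.<-asym f<x l′ ; (suc j) → avoid j }
... | no f≮x with q , l′ , u′ , avoid ← between-avoiding (f ∘ suc) l =
  q , l′ , ℚ.<-trans u′ u , λ { zero refl → f≮x u′ ; (suc j) → avoid j }

module _ {n m : ℕ} (ends : Fin m → Fin n × Fin n) where

  Steps : Set
  Steps = List (Fin m × Fin n)

  edges : Steps → List (Fin m)
  edges = map proj₁

  verts : Steps → List (Fin n)
  verts = map proj₂

  data Walk : Fin n → Steps → Fin n → Set where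
    []  : ∀ {a} → Walk a [] a
    _∷_ : ∀ {a p y ws b} → Joins ends p a y → Walk y ws b → Walk a ((p , y) ∷ ws) b

  walk-++ : ∀ {a xs b ys c} → Walk a xs b → Walk b ys c → Walk a (xs ++ ys) c
  walk-++ []      w = w
  walk-++ (j ∷ v) w = j ∷ walk-++ v w

  -- Degree at least two, given by witnesses: a loop counts twice, otherwise two different edges are
  -- needed. In this form it is visibly monotone in `S`.
  Two : (Fin m → Set) → Fin n → Set
  Two S v = (∃[ e ] S e × ends e ≡ (v , v))
          ⊎ (∃[ e ] ∃[ f ] S e × S f × e ≢ f × IncidentTo ends e v × IncidentTo ends f v)

  Two-mono : ∀ {S S′ : Fin m → Set} {v} → (∀ {e} → S e → S′ e) → Two S v → Two S′ v
  Two-mono f (inj₁ (e , s , l))                  = inj₁ (e , f s , l)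
  Two-mono f (inj₂ (e , e′ , s , s′ , ne , i , i′)) = inj₂ (e , e′ , f s , f s′ , ne , i , i′)

  joins-incˡ : ∀ {e u v} → Joins ends e u v → IncidentTo ends e u
  joins-incˡ (inj₁ p) = inj₁ (cong proj₁ p)
  joins-incˡ (inj₂ p) = inj₂ (cong proj₂ p)

  inc-joins : ∀ {e u v w} → IncidentTo ends e w → Joins ends e u v → w ≡ u ⊎ w ≡ v
  inc-joins (inj₁ i) (inj₁ j) = inj₁ (trans (sym i) (cong proj₁ j))
  inc-joins (inj₁ i) (inj₂ j) = inj₂ (trans (sym i) (cong proj₁ j))
  inc-joins (inj₂ i) (inj₁ j) = inj₂ (trans (sym i) (cong proj₂ j))
  inc-joins (inj₂ i) (inj₂ j) = inj₁ (trans (sym i) (cong proj₂ j))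

  module _ (r : Fin n) where

    -- One shape for both kinds of up chain: a path, or a cycle opened at its marked vertex.
    -- `verts steps` omits the start, so `uniqueᵛ` permits a closed walk; `closing` records what
    -- holds at the start in that case.
    record Ascent (H X : Fin m → Set) : Set where
      field
        {a b}   : Fin n
        {steps} : Steps
        walk    : Walk a steps b
        covers  : ∀ {e} → X e → e ∈ edges steps
        within  : ∀ {e} → e ∈ edges steps → X e
        uniqueᵉ : Unique (edges steps)
        uniqueᵛ : Unique (verts steps)
        start   : a ≡ r ⊎ (∃[ e ] H e × IncidentTo ends e a)
        finish  : b ≡ r ⊎ (∃[ e ] H e × IncidentTo ends e b)
        closing : (a ≡ r ⊎ Two H a) ⊎ a ∉ verts steps

    AllTwo : (S X : Fin m → Set) → Set
    AllTwo S X = ∀ {e v} → X e → IncidentTo ends e v → v ≡ r ⊎ Two S v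

    data Layer (H X Hb : Fin m → Set) : Set where
      ascending  : Ascent H X → AllTwo Hb X → Layer H X Hb
      descending : Ascent Hb X → AllTwo H X → Layer H X Hb
      oneway     : ∀ {e u v} → X e → (∀ {f} → X f → f ≡ e) → Joins ends e u v →
                   (u ≡ r ⊎ Two H u) → (v ≡ r ⊎ Two Hb v) → Layer H X Hb

-- Growing the two trees of one direction

Sides : ℕ → ℕ → Set
Sides n m = Side → Fin n → Maybe (Fin m × Fin n)

_≟ˢ_ : (σ τ : Side) → Dec (σ ≡ τ)
lo ≟ˢ lo = yes refl
lo ≟ˢ hi = no λ ()
hi ≟ˢ lo = no λ ()
hi ≟ˢ hi = yes refl

update : ∀ {k} {A : Set} → (Fin k → A) → Fin k → A → Fin k → A
update f x a y with x ≟ y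
... | yes _ = a
... | no  _ = f y

update-same : ∀ {k} {A : Set} (f : Fin k → A) x a → update f x a x ≡ a
update-same f x a with x ≟ x
... | yes _  = refl
... | no x≢x = ⊥-elim (x≢x refl)

update-other : ∀ {k} {A : Set} (f : Fin k → A) {x} a {y} → x ≢ y → update f x a y ≡ f y
update-other f {x} a {y} x≢y with x ≟ y
... | yes eq = ⊥-elim (x≢y eq)
... | no _   = refl

setSide : ∀ {n m} → Sides n m → Side → Fin n → Fin m × Fin n → Sides n m
setSide s σ v x τ w with σ ≟ˢ τ
... | yes _ = update (s τ) v (just x) w
... | no  _ = s τ w

setSide-same : ∀ {n m} (s : Sides n m) σ v x → setSide s σ v x σ v ≡ just x
setSide-same s σ v x with σ ≟ˢ σ
... | yes _  = update-same (s σ) v (just x)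
... | no σ≢σ = ⊥-elim (σ≢σ refl)

setSide-keep : ∀ {n m} (s : Sides n m) {σ v x τ w y} → s σ v ≡ nothing → s τ w ≡ just y →
               setSide s σ v x τ w ≡ just y
setSide-keep s {σ} {v} {x} {τ} {w} none p with σ ≟ˢ τ
... | no  _ = p
... | yes refl with v ≟ w
...   | no _ = p
...   | yes refl with () ← trans (sym none) p

setSide-inv : ∀ {n m} (s : Sides n m) {σ v x τ w y} → setSide s σ v x τ w ≡ just y →
              (s τ w ≡ just y) ⊎ (σ ≡ τ × v ≡ w × x ≡ y)
setSide-inv s {σ} {v} {x} {τ} {w} p with σ ≟ˢ τ
... | no _ = inj₁ p
... | yes refl with v ≟ w
...   | no _ = inj₁ p
...   | yes refl with refl ← p = inj₂ (refl , refl , refl)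

-- `V` and `E` confine the new entries: vertices outside `V` stay untouched for later ears, and
-- edges outside `E` stay free to be ranked.
record Extends {n m} (V : Fin n → Set) (E : Fin m → Set) (s s′ : Sides n m) : Set where
  field
    keep : ∀ {σ v x} → s σ v ≡ just x → s′ σ v ≡ just x
    back : ∀ {σ v e u} → s′ σ v ≡ just (e , u) → s σ v ≡ just (e , u) ⊎ (V v × E e)
open Extends public

ext-refl : ∀ {n m V E} {s : Sides n m} → Extends V E s s
ext-refl = record { keep = id ; back = inj₁ }

ext-trans : ∀ {n m V E} {s s′ s″ : Sides n m} → Extends V E s s′ → Extends V E s′ s″ → Extends V E s s″
ext-trans x y = record { keep = keep y ∘ keep x ; back = Sum.[ back x , inj₂ ] ∘ back y }

ext-mono : ∀ {n m} {V V′ : Fin n → Set} {E E′ : Fin m → Set} {s s′ : Sides n m} →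
           (∀ {v} → V v → V′ v) → (∀ {e} → E e → E′ e) → Extends V E s s′ → Extends V′ E′ s s′
ext-mono f g x = record { keep = keep x ; back = Sum.map₂ (λ { (Vv , Ee) → f Vv , g Ee }) ∘ back x }

ext-nothing : ∀ {n m V E} {s s′ : Sides n m} {σ v} → Extends V E s s′ → ¬ V v → s σ v ≡ nothing → s′ σ v ≡ nothing
ext-nothing {s′ = s′} {σ} {v} x ¬V none with s′ σ v in eq
... | nothing = refl
... | just _ with back x eq
...   | inj₁ p with () ← trans (sym none) p
...   | inj₂ (Vv , _) = ⊥-elim (¬V Vv)

-- Invariants of the partial trees

module Build {n m : ℕ} (ends : Fin m → Fin n × Fin n) (r : Fin n) (c : Fin m → ℕ) where

  -- v has degree at least two in the chains of index below j.
  Early : ℕ → Fin n → Set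
  Early j v = Two ends (λ e → c e < j) v

  Early-mono : ∀ {i j v} → i ≤ j → Early i v → Early j v
  Early-mono i≤j = Two-mono ends λ p → ℕ.<-≤-trans p i≤j

  Pends : Set
  Pends = Fin n → Maybe (Fin m × Fin n)

  -- The root has no parent edges; every rank in use lies strictly between 0 and 1.
  sentinel : Side → ℚ
  sentinel lo = 0ℚ
  sentinel hi = 1ℚ

  data At (rank : Fin m → ℚ) (s : Sides n m) (σ : Side) (v : Fin n) : ℚ → Set where
    root : v ≡ r → At rank s σ v (sentinel σ)
    set  : ∀ {e u} → s σ v ≡ just (e , u) → At rank s σ v (rank e)

  Has : Sides n m → Side → Fin n → Set
  Has s σ v = v ≡ r ⊎ ∃[ x ] s σ v ≡ just x

  Done : Sides n m → Fin n → Set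
  Done s v = ∀ σ → Has s σ v

  done : ∀ {s σ τ v} → Opp σ τ → Has s σ v → Has s τ v → Done s v
  done lohi x y lo = x
  done lohi x y hi = y
  done hilo x y lo = y
  done hilo x y hi = x

  has-at : ∀ {rank s σ v} → Has s σ v → ∃[ q ] At rank s σ v q
  has-at (inj₁ p)       = _ , root p
  has-at (inj₂ (_ , p)) = _ , set p

  at-has : ∀ {rank s σ v q} → At rank s σ v q → Has s σ v
  at-has (root p) = inj₁ p
  at-has (set p)  = inj₂ (_ , p)

  at-ext : ∀ {rank s s′ V E σ v q} → Extends V E s s′ → At rank s σ v q → At rank s′ σ v q
  at-ext x (root p) = root p
  at-ext x (set p)  = set (keep x p)

  has-ext : ∀ {s s′ V E σ v} → Extends V E s s′ → Has s σ v → Has s′ σ v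
  has-ext x = Sum.map₂ λ (y , p) → y , keep x p

  at-rerank : ∀ {rank rank′ s σ v q} → (∀ {e u} → s σ v ≡ just (e , u) → rank′ e ≡ rank e) →
              At rank s σ v q → At rank′ s σ v q
  at-rerank same (root p) = root p
  at-rerank {rank′ = rank′} {s} {σ} {v} same (set p) = subst (At rank′ s σ v) (same p) (set p)

  Toward : (Fin m → ℚ) → Sides n m → Side → Fin n → Fin m → Set
  Toward rank s σ u e = ∃[ q ] At rank s σ u q × q <[ σ ] rank e

  toward-ext : ∀ {rank s s′ V E σ u e} → Extends V E s s′ → Toward rank s σ u e → Toward rank s′ σ u e
  toward-ext x (q , at , lt) = q , at-ext x at , lt

  -- `toward` makes ranks monotone along tree `σ`. `timely` and `ready` control chain indices
  -- instead: the parent edge comes no later than the chain that brings `v` to degree two, and the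
  -- parent has degree two no later than the chain of that edge.
  record SideOK (i : ℕ) (rank : Fin m → ℚ) (s : Sides n m) (σ : Side) (v : Fin n) (e : Fin m) (u : Fin n) : Set where
    field
      notRoot : v ≢ r
      joins   : Joins ends e v u
      toward  : Toward rank s σ u e
      timely  : ∀ j → Early j v → c e < j
      ready   : u ≡ r ⊎ Early (suc (c e)) u
      current : c e ≤ i

  -- `proper` excludes a loop, whose single edge would already give `v` degree two while it is still
  -- waiting.
  record PendOK (i : ℕ) (rank : Fin m → ℚ) (s : Sides n m) (v : Fin n) (e : Fin m) (u : Fin n) : Set where
    field
      notRoot : v ≢ r
      joins   : Joins ends e v u
      toward  : ∀ σ → Toward rank s σ u e
      ready   : u ≡ r ⊎ Early (suc (c e)) u
      current : c e ≤ i
      proper  : u ≢ v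

  -- side σ v is the edge and parent of v in tree σ.  A vertex that so far is only the head of one one-way
  -- chain e has no side yet but pend v = (e , tail): the rank of e lies between those of the two parent
  -- edges of the tail, so e can later become either parent edge of v.
  record State (i : ℕ) (rank : Fin m → ℚ) (pend : Pends) : Set where
    field
      side     : Sides n m
      sideOK   : ∀ {σ v e u} → side σ v ≡ just (e , u) → SideOK i rank side σ v e u
      pendOK   : ∀ {v e u} → pend v ≡ just (e , u) → PendOK i rank side v e u
      ordered  : ∀ {σ τ v a b} → Opp σ τ → At rank side σ v a → At rank side τ v b → a <[ σ ] b
      distinct : ∀ {v w e f t u} → pend v ≡ just (e , t) → pend w ≡ just (f , u) → v ≢ w → rank e ≢ rank f
      -- While a side is unset, the chains below `i` do not give `v` degree two; hence a parent edge
      -- taken now, of index at most `i`, is still `timely`.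
      late     : ∀ {σ v} → v ≢ r → side σ v ≡ nothing → ∀ j → Early j v → i < j
  open State public

  module _ {i : ℕ} {rank : Fin m → ℚ} {pend : Pends} (S : State i rank pend) where

    at-unique : ∀ {σ v a b} → At rank (side S) σ v a → At rank (side S) σ v b → a ≡ b
    at-unique (root p) (root _) = refl
    at-unique (root p) (set q)  = ⊥-elim (SideOK.notRoot (sideOK S q) p)
    at-unique (set p)  (root q) = ⊥-elim (SideOK.notRoot (sideOK S p) q)
    at-unique (set p)  (set q)  with refl ← trans (sym p) q = refl

    -- Unless `u` is `r`, it has a `σ`-parent edge of index at most `i`. The strict rank inequality
    -- makes that edge different from `p`, and the two together give degree two.
    toward-ready : ∀ {σ u p w} → c p ≡ i → Joins ends p u w → Toward rank (side S) σ u p → u ≡ r ⊎ Early (suc (c p)) u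
    toward-ready eq j (_ , root q , lt) = inj₁ q
    toward-ready {p = p} refl j (_ , set {e} q , lt) = inj₂ (inj₂ (e , p , s≤s (SideOK.current (sideOK S q)) , ℕ.≤-refl ,
      (λ same → <σ-irrefl (cong rank same) lt) , joins-incˡ ends (SideOK.joins (sideOK S q)) , joins-incˡ ends j))

    attach : ∀ {σ τ v p u} → Opp σ τ → v ≢ r → side S σ v ≡ nothing →
             Joins ends p v u → Toward rank (side S) σ u p →
             (∀ {b} → At rank (side S) τ v b → rank p <[ σ ] b) →
             (u ≡ r ⊎ Early (suc (c p)) u) → c p ≤ i →
             Σ[ S′ ∈ State i rank pend ] Extends (_≡ v) (_≡ p) (side S) (side S′) × At rank (side S′) σ v (rank p)
    attach {σ} {τ} {v} {p} {u} o v≢r none j tow below rdy cur = S′ , ext , set (setSide-same (side S) σ v _)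
      where
      s′ = setSide (side S) σ v (p , u)
      ext : Extends (_≡ v) (_≡ p) (side S) s′
      ext = record { keep = setSide-keep (side S) {σ} {v} {p , u} none
                   ; back = λ q → Sum.map₂ (λ { (refl , refl , refl) → refl , refl }) (setSide-inv (side S) {σ} {v} {p , u} q) }
      sideOK′ : ∀ {σ′ v′ e u′} → s′ σ′ v′ ≡ just (e , u′) → SideOK i rank s′ σ′ v′ e u′
      sideOK′ q with setSide-inv (side S) {σ} {v} {p , u} q
      ... | inj₁ q′ = record { notRoot = notRoot ; joins = joins ; toward = toward-ext ext toward
                             ; timely = timely ; ready = ready ; current = current }
        where open SideOK (sideOK S q′)
      ... | inj₂ (refl , refl , refl) = record
        { notRoot = v≢r ; joins = j ; toward = toward-ext ext tow
        ; timely = λ k early → ℕ.≤-<-trans cur (late S v≢r none k early) ; ready = rdy ; current = cur }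
      at-inv : ∀ {σ′ v′ a} → At rank s′ σ′ v′ a → At rank (side S) σ′ v′ a ⊎ (σ ≡ σ′ × v ≡ v′ × a ≡ rank p)
      at-inv (root q) = inj₁ (root q)
      at-inv (set q) with setSide-inv (side S) {σ} {v} {p , u} q
      ... | inj₁ q′ = inj₁ (set q′)
      ... | inj₂ (refl , refl , refl) = inj₂ (refl , refl , refl)
      opp-det : ∀ {ρ ρ′ π} → Opp ρ π → Opp ρ′ π → ρ ≡ ρ′
      opp-det lohi lohi = refl
      opp-det hilo hilo = refl
      opp-irrefl : ∀ {ρ} → ¬ Opp ρ ρ
      opp-irrefl ()
      ordered′ : ∀ {σ′ τ′ v′ a b} → Opp σ′ τ′ → At rank s′ σ′ v′ a → At rank s′ τ′ v′ b → a <[ σ′ ] b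
      ordered′ o′ x y with at-inv x | at-inv y
      ... | inj₁ x′ | inj₁ y′ = ordered S o′ x′ y′
      ... | inj₂ (refl , refl , refl) | inj₁ y′ with refl ← opp-det (opp-sym o) (opp-sym o′) = below y′
      ... | inj₁ x′ | inj₂ (refl , refl , refl) with refl ← opp-det (opp-sym o) o′ = <-flip o (below x′)
      ... | inj₂ (refl , _) | inj₂ (refl , _) = ⊥-elim (opp-irrefl o′)
      late′ : ∀ {σ′ v′} → v′ ≢ r → s′ σ′ v′ ≡ nothing → ∀ k → Early k v′ → i < k
      late′ {σ′} {v′} ne none′ with side S σ′ v′ in eq
      ... | nothing = late S ne eq
      ... | just _ with () ← trans (sym none′) (keep ext eq)
      S′ : State i rank pend
      S′ = record
        { side = s′ ; sideOK = sideOK′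
        ; pendOK = λ q → let open PendOK (pendOK S q) in record
            { notRoot = notRoot ; joins = joins ; toward = λ ρ → toward-ext ext (toward ρ)
            ; ready = ready ; current = current ; proper = proper }
        ; ordered = ordered′ ; distinct = distinct S ; late = late′ }

    -- An end of an ear may be `r` or may own this parent already, and then nothing changes. The
    -- result is therefore `Has` and not a definite rank.
    ensure : ∀ (V : Fin n → Set) (E : Fin m → Set) {σ τ v p u} → Opp σ τ →
             Joins ends p v u → Toward rank (side S) σ u p →
             (∀ {b} → At rank (side S) τ v b → rank p <[ σ ] b) →
             c p ≡ i → V v → E p →
             Σ[ S′ ∈ State i rank pend ] Extends V E (side S) (side S′) × Has (side S′) σ v
    ensure V E {σ} {v = v} o j tow below cur Vv Ep with v ≟ r | side S σ v in eq
    ... | yes v≡r | _      = S , ext-refl , inj₁ v≡r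
    ... | no _    | just x = S , ext-refl , inj₂ (x , eq)
    ... | no v≢r  | nothing
      with S′ , ext , at ← attach o v≢r eq j tow below (toward-ready cur (joins-sym {ends = ends} j) tow) (ℕ.≤-reflexive cur)
      = S′ , ext-mono (λ { refl → Vv }) (λ { refl → Ep }) ext , at-has at

  -- Ranking an ear and adding it to the two trees

  Rising : Side → (Fin m → ℚ) → ℚ → List (Fin m) → ℚ → Set
  Rising σ rank a []       b = a <[ σ ] b
  Rising σ rank a (p ∷ ps) b = a <[ σ ] rank p × Rising σ rank (rank p) ps b

  -- Density gives each edge a rank between that of its predecessor and `b`. All other ranks stay,
  -- which is what `rerank` requires.
  place : ∀ σ (rank : Fin m → ℚ) {a b} ps → Unique ps → a <[ σ ] b →
          ∃[ rank′ ] (∀ {e} → e ∉ ps → rank′ e ≡ rank e) × Rising σ rank′ a ps b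
  place σ rank [] _ lt = rank , (λ _ → refl) , lt
  place σ rank {a} {b} (p ∷ ps) (p∉ ∷ uniq) lt
    with q , a<q , q<b ← <σ-dense lt
    with rank′ , same , rising ← place σ (update rank p q) ps uniq q<b
    = rank′ , (λ e∉ → trans (same (e∉ ∘ there)) (update-other rank q (λ p≡e → e∉ (here (sym p≡e))))) ,
      subst (a <[ σ ]_) (sym rank-p) a<q , subst (λ x → Rising σ rank′ x ps b) (sym rank-p) rising
    where
    rank-p = trans (same (All.All¬⇒¬Any p∉)) (update-same rank p q)

  rerank : ∀ {i rank pend} (S : State i rank pend) (rank′ : Fin m → ℚ) →
           (∀ {σ v e u} → side S σ v ≡ just (e , u) → rank′ e ≡ rank e) →
           (∀ {v e u} → pend v ≡ just (e , u) → rank′ e ≡ rank e) →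
           State i rank′ pend
  rerank {i} {rank} {pend} S rank′ sameˢ sameᵖ = record
    { side = side S
    ; sideOK = λ p → let open SideOK (sideOK S p) in record
        { notRoot = notRoot ; joins = joins ; toward = toward′ (sameˢ p) toward
        ; timely = timely ; ready = ready ; current = current }
    ; pendOK = λ p → let open PendOK (pendOK S p) in record
        { notRoot = notRoot ; joins = joins ; toward = λ σ → toward′ (sameᵖ p) (toward σ)
        ; ready = ready ; current = current ; proper = proper }
    ; ordered = λ o x y → ordered S o (at-rerank (sym ∘ sameˢ) x) (at-rerank (sym ∘ sameˢ) y)
    ; distinct = λ p q ne eq → distinct S p q ne (trans (sym (sameᵖ p)) (trans eq (sameᵖ q)))
    ; late = late S }
    where
    toward′ : ∀ {σ u e} → rank′ e ≡ rank e → Toward rank (side S) σ u e → Toward rank′ (side S) σ u e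
    toward′ {σ} eq (q , at , lt) = q , at-rerank sameˢ at , subst (q <[ σ ]_) (sym eq) lt

  Untouched : Sides n m → Fin n → Set
  Untouched s v = v ≢ r × (∀ σ → s σ v ≡ nothing)

  untouched-at : ∀ {rank s σ v q} → Untouched s v → ¬ At rank s σ v q
  untouched-at (v≢r , _) (root v≡r) = v≢r v≡r
  untouched-at {σ = σ} (_ , none) (set p) with () ← trans (sym (none σ)) p

  untouched-ext : ∀ {V E s s′ v} → Extends V E s s′ → ¬ V v → Untouched s v → Untouched s′ v
  untouched-ext x ¬V (v≢r , none) = v≢r , λ σ → ext-nothing x ¬V (none σ)

  -- The σ-parents are set while walking from a to b, and the opposite parents on the way back.
  ear : ∀ {i rank pend} (V : Fin n → Set) (E : Fin m → Set) {σ τ} → Opp σ τ →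
        (S : State i rank pend) → ∀ {a acc x p b qa qb} →
        Walk ends a acc x → Joins ends p x b →
        At rank (side S) σ a qa → At rank (side S) τ b qb → Rising σ rank qa (edges ends acc ∷ʳ p) qb →
        All (Untouched (side S)) (verts ends acc) → Unique (verts ends acc) →
        All (λ e → c e ≡ i × E e) (edges ends acc ∷ʳ p) → All V (verts ends acc) → V a → V b →
        Σ[ S′ ∈ State i rank pend ] Extends V E (side S) (side S′)
          × Has (side S′) τ a × All (Done (side S′)) (verts ends acc) × Has (side S′) σ b
  ear V E o S {acc = []} [] j ata atb (a<p , p<b) _ _ ((cp , Ep) ∷ []) _ Va Vb
    with S₁ , x₁ , hasb ← ensure S V E o (joins-sym {ends = ends} j) (_ , ata , a<p)
                            (λ at → subst (_ <[ _ ]_) (at-unique S atb at) p<b) cp Vb Ep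
    with S₂ , x₂ , hasa ← ensure S₁ V E (opp-sym o) j (_ , at-ext x₁ atb , <-flip o p<b)
                            (λ at → <-flip o (subst (_<[ _ ] _) (at-unique S₁ (at-ext x₁ ata) at) a<p)) cp Va Ep
    = S₂ , ext-trans x₁ x₂ , hasa , [] , has-ext x₂ hasb
  ear V E {σ} {τ} o S {acc = (p , y) ∷ acc} (j ∷ walk) jₑ ata atb (a<p , rising)
      (new ∷ news) (y∉ ∷ uniq) ((cp , Ep) ∷ es) (Vy ∷ Vs) Va Vb
    with S₁ , x₁ , aty ← attach S o (proj₁ new) (proj₂ new σ) (joins-sym {ends = ends} j) (_ , ata , a<p)
           (λ at → ⊥-elim (untouched-at new at)) (toward-ready S cp j (_ , ata , a<p)) (ℕ.≤-reflexive cp)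
    with S₂ , x₂ , hasy , dones , hasb ← ear V E o S₁ walk jₑ aty (at-ext x₁ atb) rising
           (All.zipWith (λ { (y≢w , w-new) → untouched-ext x₁ (y≢w ∘ sym) w-new }) (y∉ , news)) uniq es Vs Vy Vb
    with q , atτ ← has-at hasy
    -- The `σ`-parent edge of `y` is `p`, so `ordered` at `y` puts the `τ`-rank of `y` beyond
    -- `rank p` on side `σ`. This is the inequality that lets `p` also be the `τ`-parent edge of
    -- `a`, with parent `y`.
    with S₃ , x₃ , hasa ← ensure S₂ V E (opp-sym o) j (q , atτ , <-flip o (ordered S₂ o (at-ext x₂ aty) atτ))
           (λ at → <-flip o (subst (_<[ _ ] _) (at-unique S₂ (at-ext x₂ (at-ext x₁ ata)) at) a<p)) cp Va Ep
    = S₃ , ext-trans (ext-mono (λ { refl → Vy }) (λ { refl → Ep }) x₁) (ext-trans x₂ x₃) , hasa ,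
      done {side S₃} o (has-ext x₃ (has-ext x₂ (at-has aty))) (has-ext x₃ hasy) ∷ All.map (λ d σ → has-ext x₃ (d σ)) dones ,
      has-ext x₃ hasb

  -- The status of a vertex and the direction of an ear

  NoHalf : Sides n m → Set
  NoHalf s = ∀ {σ v x} → s σ v ≡ just x → ∀ τ → ∃[ y ] s τ v ≡ just y

  -- Entries of `pend` are never erased, so a vertex counts as waiting only while both its sides are
  -- unset.
  Pending : Pends → Sides n m → Fin n → Set
  Pending pend s v = ∃[ x ] pend v ≡ just x × (∀ τ → s τ v ≡ nothing)

  Touched : Pends → Sides n m → Fin n → Set
  Touched pend s v = Done s v ⊎ Pending pend s v

  New : Pends → Sides n m → Fin n → Set
  New pend s v = Untouched s v × pend v ≡ nothing

  -- Half-finished vertices occur only while an ear or a waiting vertex is being processed.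
  -- Elsewhere `NoHalf` holds and the `lo` side alone settles both.
  status : ∀ pend {s} → NoHalf s → ∀ v → Touched pend s v ⊎ New pend s v
  status pend {s} full v with v ≟ r | s lo v in eq
  ... | yes v≡r | _       = inj₁ (inj₁ λ _ → inj₁ v≡r)
  ... | no _    | just _  = inj₁ (inj₁ λ σ → inj₂ (full eq σ))
  ... | no v≢r  | nothing = go (pend v) refl
    where
    none : ∀ σ → s σ v ≡ nothing
    none σ with s σ v in eqσ
    ... | nothing = refl
    ... | just _ with _ , p ← full eqσ lo with () ← trans (sym eq) p
    go : ∀ x → pend v ≡ x → Touched pend s v ⊎ New pend s v
    go (just x) p = inj₁ (inj₂ (x , p , none))
    go nothing  p = inj₂ ((v≢r , none) , p)

  done-untouched : ∀ s {v} → Done s v → ¬ Untouched s v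
  done-untouched s d (v≢r , none) with d lo
  ... | inj₁ v≡r = v≢r v≡r
  ... | inj₂ (_ , p) with () ← trans (sym (none lo)) p

  touched-new : ∀ pend s {v} → Touched pend s v → ¬ New pend s v
  touched-new pend s (inj₁ d) (new , _) = done-untouched s d new
  touched-new pend s (inj₂ (_ , p , _)) (_ , none) with () ← trans (sym none) p

  done-at : ∀ rank s {v} → Done s v → ∀ σ → ∃[ q ] At rank s σ v q
  done-at rank s d σ = has-at (d σ)

  -- The rank that `v` can offer on side `σ`; a waiting edge offers the same rank on either side.
  data Cand {i rank pend} (S : State i rank pend) (σ : Side) (v : Fin n) : ℚ → Set where
    held   : ∀ {q} → At rank (side S) σ v q → Cand S σ v q
    pended : ∀ {e u} → pend v ≡ just (e , u) → (∀ τ → side S τ v ≡ nothing) → Cand S σ v (rank e)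

  Pended : Pends → Fin m → Set
  Pended pend e = ∃₂ λ v u → pend v ≡ just (e , u)

  activate : ∀ {i rank pend} (S : State i rank pend) {σ τ v q} → Opp σ τ → Cand S σ v q →
             Σ[ S′ ∈ State i rank pend ] Extends (_≡ v) (Pended pend) (side S) (side S′) × At rank (side S′) σ v q
  activate S o (held x) = S , ext-refl , x
  activate S {σ} o (pended {e} {u} p none)
    with S′ , x , a ← (let open PendOK (pendOK S p) in
           attach S o notRoot (none σ) joins (toward σ) (λ b → ⊥-elim (untouched-at (notRoot , none) b)) ready current)
    = S′ , ext-mono id (λ { refl → _ , _ , p }) x , a

  -- If the `lo`-rank of `u` is below the `hi`-rank of `v`, the ear rises. Otherwise
  -- `lo v ≤ hi v ≤ lo u ≤ hi u` in terms of ranks, and it falls from `hi u` to `lo v`. For a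
  -- waiting vertex the two ranks coincide, so strictness comes from the end that is done, or from
  -- `distinct` if both ends wait.
  choose : ∀ {i rank pend} (S : State i rank pend) {u v} →
           Done (side S) u ⊎ (Pending pend (side S) u × u ≢ v) → Touched pend (side S) v →
           ∃₂ λ σ τ → Opp σ τ × ∃₂ λ a b → Cand S σ u a × Cand S τ v b × a <[ σ ] b
  choose {rank = rank} {pend} S {u} {v} (inj₁ du) tv = go tv
    where
    atu = λ σ → proj₂ (done-at rank (side S) du σ)
    compare : ∀ {a b} → Cand S lo v a → Cand S hi v b → a ℚ.≤ b →
              ∃₂ λ σ τ → Opp σ τ × ∃₂ λ a b → Cand S σ u a × Cand S τ v b × a <[ σ ] b
    compare {a} {b} ca cb a≤b with proj₁ (done-at rank (side S) du lo) ℚ.<? b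
    ... | yes lt = lo , hi , lohi , _ , _ , held (atu lo) , cb , up lt
    ... | no ≮ with up lt ← ordered S lohi (atu lo) (atu hi) =
      hi , lo , hilo , _ , _ , held (atu hi) , ca , down (ℚ.≤-<-trans (ℚ.≤-trans a≤b (ℚ.≮⇒≥ ≮)) lt)
    go : Touched pend (side S) v → ∃₂ λ σ τ → Opp σ τ × ∃₂ λ a b → Cand S σ u a × Cand S τ v b × a <[ σ ] b
    go (inj₁ dv) with up lt ← ordered S lohi (proj₂ (done-at rank (side S) dv lo)) (proj₂ (done-at rank (side S) dv hi)) =
      compare (held (proj₂ (done-at rank (side S) dv lo))) (held (proj₂ (done-at rank (side S) dv hi))) (ℚ.<⇒≤ lt)
    go (inj₂ (_ , p , none)) = compare (pended p none) (pended p none) ℚ.≤-refl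
  choose {rank = rank} S {u} {v} (inj₂ (((e , _) , p , none) , u≢v)) (inj₂ ((f , _) , q , none′))
    with σ , τ , o , lt ← <σ-connex (rank e) (rank f) (distinct S p q u≢v)
    = σ , τ , o , _ , _ , pended p none , pended q none′ , lt
  choose {rank = rank} S {u} {v} (inj₂ (((e , _) , p , none) , u≢v)) (inj₁ dv)
    with a , ata ← done-at rank (side S) dv lo | b , atb ← done-at rank (side S) dv hi with rank e ℚ.<? b
  ... | yes lt = lo , hi , lohi , _ , _ , pended p none , held atb , up lt
  ... | no ≮ with up lt ← ordered S lohi ata atb =
    hi , lo , hilo , _ , _ , pended p none , held ata , down (ℚ.<-≤-trans lt (ℚ.≮⇒≥ ≮))

  cand-ext : ∀ {i rank pend} {S S′ : State i rank pend} {a E τ b q} → (b ≡ a → Done (side S) b) →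
             Extends (_≡ a) E (side S) (side S′) → Cand S τ b q → Cand S′ τ b q
  cand-ext _ x (held y) = held (at-ext x y)
  cand-ext {S = S} same x (pended p none) =
    pended p λ τ → ext-nothing x (λ eq → done-untouched (side S) (same eq) (PendOK.notRoot (pendOK S p) , none)) (none τ)

  FreshEdge : Pends → Sides n m → Fin m → Set
  FreshEdge pend s e = (∀ {σ v u} → s σ v ≢ just (e , u)) × ¬ Pended pend e

  Linked : ∀ {i rank pend} → State i rank pend → Fin n → Steps ends → Fin m → Fin n → Set
  Linked {i} {rank} {pend} S a acc p b = ∃[ rank′ ] Σ[ S′ ∈ State i rank′ pend ]
    Extends (_∈ a ∷ b ∷ verts ends acc) (λ e → e ∈ edges ends acc ∷ʳ p ⊎ Pended pend e) (side S) (side S′)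
    × NoHalf (side S′) × (∀ {v} → v ∈ a ∷ b ∷ verts ends acc → Done (side S′) v)

  -- The ear needs the `σ`-rank of `a` and the `τ`-rank of `b`. A waiting end receives that parent
  -- by activation and its other parent from the ear, so no half-finished vertex survives. The new
  -- edges are fresh, so ranking them disturbs nothing.
  connect : ∀ {i rank pend} (S : State i rank pend) → NoHalf (side S) → ∀ {a acc x p b} →
            Walk ends a acc x → Joins ends p x b →
            Done (side S) a ⊎ (Pending pend (side S) a × a ≢ b) → Touched pend (side S) b →
            All (New pend (side S)) (verts ends acc) → Unique (verts ends acc) →
            Unique (edges ends acc ∷ʳ p) → All (λ e → c e ≡ i × FreshEdge pend (side S) e) (edges ends acc ∷ʳ p) →
            Linked S a acc p b
  connect {i} {rank} {pend} S full {a} {acc} {x} {p} {b} walk j ta tb news uniqᵛ uniqᵉ fresh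
    with σ , τ , o , qa , qb , ca , cb , lt ← choose S ta tb
    with S₁ , x₁ , ata ← activate S o ca
    with S₂ , x₂ , atb ← activate S₁ (opp-sym o) (cand-ext {S = S} {S₁} (λ { refl → Sum.[ id , (λ { (_ , ne) → ⊥-elim (ne refl) }) ] ta }) x₁ cb)
    with rank′ , same , rising ← place σ rank (edges ends acc ∷ʳ p) uniqᵉ lt
    = rank′ , finish
    where
    V = _∈ a ∷ b ∷ verts ends acc
    E = λ e → e ∈ edges ends acc ∷ʳ p ⊎ Pended pend e
    x₁₂ : Extends V E (side S) (side S₂)
    x₁₂ = ext-trans (ext-mono (λ { refl → here refl }) inj₂ x₁) (ext-mono (λ { refl → there (here refl) }) inj₂ x₂)
    sameˢ : ∀ {σ v e u} → side S₂ σ v ≡ just (e , u) → rank′ e ≡ rank e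
    sameˢ p = same λ e∈ → let _ , no-side , no-pend = All.lookup fresh e∈ in
      Sum.[ Sum.[ no-side , no-pend ∘ proj₂ ] ∘ back x₁ , no-pend ∘ proj₂ ] (back x₂ p)
    sameᵖ : ∀ {v e u} → pend v ≡ just (e , u) → rank′ e ≡ rank e
    sameᵖ p = same λ e∈ → proj₂ (proj₂ (All.lookup fresh e∈)) (_ , _ , p)
    S₃ : State i rank′ pend
    S₃ = rerank S₂ rank′ sameˢ sameᵖ
    old-a : Touched pend (side S) a
    old-a = Sum.map₂ proj₁ ta
    news₃ : All (Untouched (side S₃)) (verts ends acc)
    news₃ = All.map (λ new → untouched-ext x₂ (λ { refl → touched-new pend (side S) tb new })
                             (untouched-ext x₁ (λ { refl → touched-new pend (side S) old-a new }) (proj₁ new))) news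
    finish : Σ[ S′ ∈ State i rank′ pend ] Extends V E (side S) (side S′) × NoHalf (side S′) × (∀ {v} → V v → Done (side S′) v)
    finish
      with S₄ , x₄ , hasa , dones , hasb ← ear V E o S₃ walk j (at-rerank sameˢ (at-ext x₂ ata)) (at-rerank sameˢ atb) rising
             news₃ uniqᵛ (All.tabulate λ e∈ → proj₁ (All.lookup fresh e∈) , inj₁ e∈)
             (All.tabulate (there ∘ there)) (here refl) (there (here refl))
      = S₄ , ext , full′ , done′
      where
      ext = ext-trans x₁₂ x₄
      done′ : ∀ {v} → V v → Done (side S₄) v
      done′ (here refl)         = done {side S₄} o (has-ext x₄ (has-ext x₂ (at-has ata))) hasa
      done′ (there (here refl)) = done {side S₄} o hasb (has-ext x₄ (at-has atb))
      done′ (there (there v∈))  = All.lookup dones v∈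
      full′ : NoHalf (side S₄)
      full′ p τ with back ext p
      ... | inj₁ old = let _ , q = full old τ in _ , keep ext q
      ... | inj₂ (Vv , _) with done′ Vv τ
      ...   | inj₁ v≡r = ⊥-elim (SideOK.notRoot (sideOK S₄ p) v≡r)
      ...   | inj₂ q = q

  -- Cutting an up chain into ears

  walk-last : ∀ {a xs b} → Walk ends a xs b → xs ≡ [] ⊎ b ∈ verts ends xs
  walk-last [] = inj₁ refl
  walk-last (j ∷ []) = inj₂ (here refl)
  walk-last (j ∷ w@(_ ∷ _)) with walk-last w
  ... | inj₂ b∈ = inj₂ (there b∈)

  walk-inc : ∀ {a xs b e v} → Walk ends a xs b → e ∈ edges ends xs → IncidentTo ends e v → v ∈ a ∷ verts ends xs
  walk-inc (j ∷ w) (here refl) i with inc-joins ends i j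
  ... | inj₁ refl = here refl
  ... | inj₂ refl = there (here refl)
  walk-inc (j ∷ w) (there e∈) i = there (walk-inc w e∈ i)

  step-inc : ∀ {a acc x p y es e v} → Walk ends a acc x → Joins ends p x y → e ∈ edges ends acc ++ p ∷ es →
             IncidentTo ends e v → v ∈ a ∷ y ∷ verts ends acc ⊎ e ∈ es
  step-inc {a} {acc} {y = y} walk j e∈ i with ∈-++⁻ (edges ends acc) e∈
  ... | inj₂ (there e∈′) = inj₂ e∈′
  ... | inj₁ e∈′         = inj₁ (insert (walk-inc walk e∈′ i))
    where
    insert : ∀ {v} → v ∈ a ∷ verts ends acc → v ∈ a ∷ y ∷ verts ends acc
    insert (here q)  = here q
    insert (there q) = there (there q)
  ... | inj₂ (here refl) with inc-joins ends i j
  ...   | inj₂ refl = inj₁ (there (here refl))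
  ...   | inj₁ refl = inj₁ (end walk (walk-last walk))
    where
    end : ∀ {a acc x} → Walk ends a acc x → acc ≡ [] ⊎ x ∈ verts ends acc → x ∈ a ∷ y ∷ verts ends acc
    end [] (inj₁ refl) = here refl
    end _  (inj₂ x∈)   = there (there x∈)

  Known : Pends → Sides n m → Fin n → Set
  Known pend s v = v ≡ r ⊎ (∃₂ λ σ x → s σ v ≡ just x) ⊎ (∃[ x ] pend v ≡ just x)

  known-new : ∀ pend s {v} → Known pend s v → ¬ New pend s v
  known-new pend s (inj₁ p) ((v≢r , _) , _) = v≢r p
  known-new pend s (inj₂ (inj₁ (σ , _ , p))) ((_ , none) , _) with () ← trans (sym p) (none σ)
  known-new pend s (inj₂ (inj₂ (_ , p))) (_ , none) with () ← trans (sym p) none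

  Keeps : Sides n m → Sides n m → Set
  Keeps s s′ = ∀ {σ v x} → s σ v ≡ just x → s′ σ v ≡ just x

  done-keep : ∀ s s′ {v} → Keeps s s′ → Done s v → Done s′ v
  done-keep s s′ k d σ = Sum.map₂ (λ (x , p) → x , k p) (d σ)

  -- A waiting start must not recur on the walk: an ear from it back to itself would have equal
  -- ranks at its ends and no gap to fill. A start that is done has the gap between its own two
  -- ranks.
  Start : Pends → Sides n m → Fin n → List (Fin n) → Set
  Start pend s a vs = Done s a ⊎ (Pending pend s a × a ∉ vs)

  map-∷ʳ-++ : ∀ {A B : Set} (f : A → B) xs x ys → map f (xs ∷ʳ x) ++ map f ys ≡ map f xs ++ f x ∷ map f ys
  map-∷ʳ-++ f xs x ys = trans (cong (_++ map f ys) (map-++ f xs _)) (∷ʳ-++ (map f xs) _ _)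

  -- acc is the part of the chain walked since the last vertex a that was already touched.
  run : ∀ {i rank pend} (S : State i rank pend) → NoHalf (side S) → ∀ {a acc x ws b} →
        Walk ends a acc x → Walk ends x ws b → Start pend (side S) a (verts ends ws) → Known pend (side S) b →
        All (New pend (side S)) (verts ends acc) →
        Unique (verts ends acc ++ verts ends ws) → Unique (edges ends acc ++ edges ends ws) →
        All (λ e → c e ≡ i × FreshEdge pend (side S) e) (edges ends acc ++ edges ends ws) →
        ∃[ rank′ ] Σ[ S′ ∈ State i rank′ pend ] Keeps (side S) (side S′) × NoHalf (side S′) ×
          (∀ {e v} → e ∈ edges ends acc ++ edges ends ws → IncidentTo ends e v → Done (side S′) v)
  run {rank = rank} {pend} S full walk [] st known news _ _ _ with walk-last walk
  ... | inj₁ refl = rank , S , id , full , λ ()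
  -- `b` is known whereas all of `acc` is new, so the walk cannot stop inside an unfinished ear.
  ... | inj₂ b∈ = ⊥-elim (known-new pend (side S) known (All.lookup news b∈))
  run {i} {rank} {pend} S full {a} {acc} {x} {(p , y) ∷ ws} {b} walk (j ∷ rest) st known news uᵛ uᵉ fresh
    with status pend {side S} full y
  ... | inj₂ new
    with eqᵛ ← map-∷ʳ-++ proj₂ acc (p , y) ws | eqᵉ ← map-∷ʳ-++ proj₁ acc (p , y) ws
    with rank′ , S′ , k , full′ , dones ← run S full {acc = acc ∷ʳ (p , y)} (walk-++ ends walk (j ∷ [])) rest
        (Sum.map₂ (λ (pa , a∉) → pa , a∉ ∘ there) st) known
        (subst (All _) (sym (map-++ proj₂ acc _)) (All.++⁺ news (new ∷ [])))
        (subst Unique (sym eqᵛ) uᵛ) (subst Unique (sym eqᵉ) uᵉ) (subst (All _) (sym eqᵉ) fresh)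
    = rank′ , S′ , k , full′ , λ e∈ → dones (subst (_ ∈_) (sym eqᵉ) e∈)
  ... | inj₁ touched
    = let uᵛ′ , uᵛ″ , _ = Unique-++⁻ (verts ends acc) uᵛ
          uᵉ′ , uᵉ″ , disj = Unique-++⁻ (edges ends acc ∷ʳ p) (subst Unique eqᵉ uᵉ)
          fresh₁ , fresh₂ = All.++⁻ (edges ends acc ∷ʳ p) (subst (All _) eqᵉ fresh)
      in continue (AllPairs.tail uᵛ″) uᵉ″ disj fresh₂
           (connect S full walk j (Sum.map₂ (λ (pa , a∉) → pa , a∉ ∘ here) st) touched news uᵛ′ uᵉ′ fresh₁)
    where
    eqᵉ = sym (∷ʳ-++ (edges ends acc) p (edges ends ws))
    continue : Unique (verts ends ws) → Unique (edges ends ws) →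
      (∀ {e} → e ∈ edges ends acc ∷ʳ p → e ∉ edges ends ws) →
      All (λ e → c e ≡ i × FreshEdge pend (side S) e) (edges ends ws) → Linked S a acc p y →
      ∃[ rank′ ] Σ[ S′ ∈ State i rank′ pend ] Keeps (side S) (side S′) × NoHalf (side S′) ×
          (∀ {e v} → e ∈ edges ends acc ++ p ∷ edges ends ws → IncidentTo ends e v → Done (side S′) v)
    continue uᵛ′ uᵉ′ disj fresh′ (rank₁ , S₁ , x₁ , full₁ , dones₁) =
      -- The ear has just finished `y`, which starts the next ear with an empty `acc`.
      let rank₂ , S₂ , k₂ , full₂ , dones₂ = run S₁ full₁ {acc = []} [] rest (inj₁ (dones₁ (there (here refl))))
            (Sum.map₂ (Sum.map₁ (λ (σ , z , q) → σ , z , keep x₁ q)) known) [] uᵛ′ uᵉ′ fresh″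
      in rank₂ , S₂ , k₂ ∘ keep x₁ , full₂ ,
         λ e∈ i → Sum.[ (λ v∈ → done-keep (side S₁) (side S₂) k₂ (dones₁ v∈)) , (λ e∈′ → dones₂ e∈′ i) ]
                      (step-inc walk j e∈ i)
      where
      still-fresh : ∀ {e σ v u} → e ∈ edges ends ws → side S₁ σ v ≢ just (e , u)
      still-fresh e∈ q with All.lookup fresh′ e∈ | back x₁ q
      ... | _ , no-side , _ | inj₁ q′             = no-side q′
      ... | _ , _ , no-pend | inj₂ (_ , inj₂ q′)  = no-pend q′
      ... | _               | inj₂ (_ , inj₁ e∈′) = disj e∈′ e∈
      fresh″ : All (λ e → c e ≡ i × FreshEdge pend (side S₁) e) (edges ends ws)
      fresh″ = All.tabulate λ e∈ → let ce , _ , no-pend = All.lookup fresh′ e∈ in ce , still-fresh e∈ , no-pend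

  -- Passing from one chain to the next

  Cover : ℕ → Pends → Sides n m → Set
  Cover j pend s = ∀ {e v} → c e < j → IncidentTo ends e v → Done s v ⊎ (∃[ u ] pend v ≡ just (e , u))

  -- `State i` also has to hold while chain `i` is being processed. The strict bounds `usedˢ` and
  -- `usedᵖ` belong to the moment before, and make every edge of chain `i` fresh.
  record Boundary (i : ℕ) (rank : Fin m → ℚ) (pend : Pends) : Set where
    field
      state : State i rank pend
      full  : NoHalf (side state)
      cover : Cover i pend (side state)
      usedˢ : ∀ {σ v e u} → side state σ v ≡ just (e , u) → c e < i
      usedᵖ : ∀ {v e u} → pend v ≡ just (e , u) → c e < i

  -- Where `Cover` offers only a waiting edge, that edge is the given one and is not a loop. One
  -- such edge cannot account for degree two.
  early-done : ∀ {i rank pend} (S : State i rank pend) {j v} → Cover j pend (side S) → Early j v → Done (side S) v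
  early-done S cover (inj₁ (e , lt , loop)) with cover lt (inj₁ (cong proj₁ loop))
  ... | inj₁ d = d
  ... | inj₂ (u , p) with PendOK.joins (pendOK S p)
  ...   | inj₁ q = ⊥-elim (PendOK.proper (pendOK S p) (cong proj₂ (trans (sym q) loop)))
  ...   | inj₂ q = ⊥-elim (PendOK.proper (pendOK S p) (cong proj₁ (trans (sym q) loop)))
  early-done S cover (inj₂ (e , f , lt , lt′ , e≢f , i , i′)) with cover lt i | cover lt′ i′
  ... | inj₁ d | _ = d
  ... | _ | inj₁ d = d
  ... | inj₂ (_ , p) | inj₂ (_ , q) with refl ← trans (sym p) q = ⊥-elim (e≢f refl)

  advance : ∀ {i rank pend} (S : State i rank pend) → NoHalf (side S) → Cover (suc i) pend (side S) →
            Boundary (suc i) rank pend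
  advance S full cover = record
    { state = record
      { side = side S
      ; sideOK = λ p → let open SideOK (sideOK S p) in record
          { notRoot = notRoot ; joins = joins ; toward = toward ; timely = timely
          ; ready = ready ; current = ℕ.m≤n⇒m≤1+n current }
      ; pendOK = λ p → let open PendOK (pendOK S p) in record
          { notRoot = notRoot ; joins = joins ; toward = toward
          ; ready = ready ; current = ℕ.m≤n⇒m≤1+n current ; proper = proper }
      ; ordered = ordered S ; distinct = distinct S
      -- The bound rises from `i` to `suc i`: degree two in the chains up to `i` would by
      -- `early-done` have set both sides.
      ; late = λ v≢r none j early → ℕ.≰⇒> λ j≤ → not-done v≢r none (early-done S cover (Early-mono j≤ early)) }
    ; full = full ; cover = cover
    ; usedˢ = λ p → s≤s (SideOK.current (sideOK S p))
    ; usedᵖ = λ p → s≤s (PendOK.current (pendOK S p)) }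
    where
    not-done : ∀ {σ v} → v ≢ r → side S σ v ≡ nothing → ¬ Done (side S) v
    not-done {σ} v≢r none d with d σ
    ... | inj₁ v≡r = v≢r v≡r
    ... | inj₂ (_ , p) with () ← trans (sym none) p

  module LayerStep {i rank pend} (B : Boundary i rank pend) where
    open Boundary B
    private S = state

    extend-cover : ∀ {pend′ s′} → (∀ {v} → Done (side S) v → Done s′ v) →
      (∀ {e v u} → pend v ≡ just (e , u) → Done s′ v ⊎ (∃[ u ] pend′ v ≡ just (e , u))) →
      (∀ {e v} → c e ≡ i → IncidentTo ends e v → Done s′ v ⊎ (∃[ u ] pend′ v ≡ just (e , u))) →
      Cover (suc i) pend′ s′
    extend-cover f g new lt inc with ℕ.m<1+n⇒m<n∨m≡n lt
    ... | inj₂ eq  = new eq inc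
    ... | inj₁ lt′ = Sum.[ inj₁ ∘ f , g ∘ proj₂ ] (cover lt′ inc)

    root-or-two : ∀ {v} → v ≡ r ⊎ Early i v → Done (side S) v
    root-or-two (inj₁ p) σ = inj₁ p
    root-or-two (inj₂ t) = early-done S cover t

    unchanged : (∀ {e v} → c e ≡ i → IncidentTo ends e v → Done (side S) v) → Boundary (suc i) rank pend
    unchanged new = advance S full (extend-cover id (λ p → inj₂ (_ , p)) λ eq inc → inj₁ (new eq inc))

    ascend : Ascent ends r (λ e → c e < i) (λ e → c e ≡ i) → ∃[ rank′ ] Boundary (suc i) rank′ pend
    ascend A = finish (run S full [] walk startA (known finishA) [] uniqueᵛ uniqueᵉ (All.tabulate fresh))
      where
      open Ascent A renaming (finish to finishA)
      known : ∀ {v} → v ≡ r ⊎ (∃[ e ] c e < i × IncidentTo ends e v) → Known pend (side S) v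
      known (inj₁ v≡r) = inj₁ v≡r
      known (inj₂ (e , lt , inc)) with cover lt inc
      ... | inj₂ (_ , p) = inj₂ (inj₂ (_ , p))
      ... | inj₁ d with d lo
      ...   | inj₁ v≡r     = inj₁ v≡r
      ...   | inj₂ (_ , p) = inj₂ (inj₁ (_ , _ , p))
      startA : Start pend (side S) a (verts ends steps)
      startA with closing | status pend {side S} full a
      ... | inj₁ two | _                = inj₁ (root-or-two two)
      ... | inj₂ _   | inj₁ (inj₁ d)    = inj₁ d
      ... | inj₂ a∉  | inj₁ (inj₂ p)    = inj₂ (p , a∉)
      ... | inj₂ _   | inj₂ new         = ⊥-elim (known-new pend (side S) (known start) new)
      fresh : ∀ {e} → e ∈ edges ends steps → c e ≡ i × FreshEdge pend (side S) e
      fresh e∈ = within e∈ , (λ p → ℕ.<-irrefl (within e∈) (usedˢ p)) , λ (_ , _ , p) → ℕ.<-irrefl (within e∈) (usedᵖ p)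
      finish : (∃[ rank′ ] Σ[ S′ ∈ State i rank′ pend ] Keeps (side S) (side S′) × NoHalf (side S′) ×
                (∀ {e v} → e ∈ edges ends steps → IncidentTo ends e v → Done (side S′) v)) →
               ∃[ rank′ ] Boundary (suc i) rank′ pend
      finish (rank′ , S′ , k , full′ , dones) = rank′ , advance S′ full′
        (extend-cover (λ d → done-keep (side S) (side S′) k d) (λ p → inj₂ (_ , p)) λ eq inc → inj₁ (dones (covers eq) inc))

    module OneWay {p u v} (cp : c p ≡ i) (only : ∀ {f} → c f ≡ i → f ≡ p) (j : Joins ends p u v)
                  (done-u : Done (side S) u) where

      unused-side : ∀ {σ w e t} → side S σ w ≡ just (e , t) → p ≢ e
      unused-side q refl = ℕ.<-irrefl cp (usedˢ q)

      unused-pend : ∀ {w e t} → pend w ≡ just (e , t) → p ≢ e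
      unused-pend q refl = ℕ.<-irrefl cp (usedᵖ q)

      done-p : ∀ {s : Sides n m} → Done s u → Done s v → ∀ {e w} → c e ≡ i → IncidentTo ends e w → Done s w
      done-p du dv eq inc with refl ← only eq with inc-joins ends inc j
      ... | inj₁ refl = du
      ... | inj₂ refl = dv

      record Ranked : Set where
        field
          rank′  : Fin m → ℚ
          same   : ∀ {e} → p ≢ e → rank′ e ≡ rank e
          apart  : ∀ {e} → p ≢ e → rank′ e ≢ rank′ p
          toward : ∀ σ → Toward rank′ (side S) σ u p

      -- The new rank lies between the two parent ranks of the tail, so that `p` can serve either
      -- tree, and it avoids all ranks present.
      ranked : Ranked
      ranked with a , ata ← done-at rank (side S) done-u lo | b , atb ← done-at rank (side S) done-u hi
        with up a<b ← ordered S lohi ata atb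
        with q , a<q , q<b , avoid ← between-avoiding rank a<b = record
        { rank′ = update rank p q
        ; same = update-other rank q
        ; apart = λ p≢e eq → avoid _ (trans (sym (update-other rank q p≢e)) (trans eq (update-same rank p q)))
        ; toward = λ { lo → a , at-rerank (update-other rank q ∘ unused-side) ata , subst (a <[ lo ]_) (sym (update-same rank p q)) (up a<q)
                     ; hi → b , at-rerank (update-other rank q ∘ unused-side) atb , subst (b <[ hi ]_) (sym (update-same rank p q)) (down q<b) } }
      open Ranked ranked

      S₁ : State i rank′ pend
      S₁ = rerank S rank′ (same ∘ unused-side) (same ∘ unused-pend)

      -- Both `f` and `p` can serve either tree, so their ranks decide: the smaller becomes the
      -- `lo`-parent edge of `v`, the larger the `hi`-parent edge.
      pending-head : Pending pend (side S) v → Boundary (suc i) rank′ pend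
      pending-head ((f , t) , q , none)
        with σ , τ , o , lt ← <σ-connex (rank′ f) (rank′ p) (apart (unused-pend q))
        with S₂ , x₂ , at₂ ← (let open PendOK (pendOK S₁ q) renaming (toward to toward-t) in
             attach S₁ o notRoot (none σ) joins (toward-t σ) (λ b → ⊥-elim (untouched-at (notRoot , none) b)) ready current)
        with S₃ , x₃ , has₃ ← ensure S₂ (_≡ v) (λ _ → ⊤) (opp-sym o) (joins-sym {ends = ends} j)
             (toward-ext x₂ (toward τ)) (λ at → subst (_ <[ τ ]_) (at-unique S₂ at₂ at) (<-flip o lt)) cp refl tt
        = advance S₃ full₃ (extend-cover keep-done (λ q → inj₂ (_ , q)) λ eq inc → inj₁ (done-p (keep-done done-u) done-v eq inc))
        where
        done-v : Done (side S₃) v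
        done-v = done {side S₃} o (has-ext x₃ (at-has at₂)) has₃
        keep-done : ∀ {w} → Done (side S) w → Done (side S₃) w
        keep-done d σ = has-ext x₃ (has-ext x₂ (d σ))
        full₃ : NoHalf (side S₃)
        full₃ q τ with back (ext-trans (ext-mono id (λ _ → tt) x₂) x₃) q
        ... | inj₁ old = let _ , z = full old τ in _ , keep x₃ (keep x₂ z)
        ... | inj₂ (refl , _) with done-v τ
        ...   | inj₁ v≡r = ⊥-elim (SideOK.notRoot (sideOK S₃ q) v≡r)
        ...   | inj₂ z   = z

      new-head : New pend (side S) v → Boundary (suc i) rank′ (update pend v (just (p , u)))
      new-head ((v≢r , none) , no-pend) = advance S₂ full (extend-cover id keep-pend new)
        where
        pend′ = update pend v (just (p , u))
        v≢u : v ≢ u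
        v≢u refl = done-untouched (side S) done-u (v≢r , none)
        pend′-inv : ∀ {w e t} → pend′ w ≡ just (e , t) → pend w ≡ just (e , t) ⊎ (v ≡ w × (p , u) ≡ (e , t))
        pend′-inv {w} q with v ≟ w
        ... | no _     = inj₁ q
        ... | yes refl with refl ← q = inj₂ (refl , refl)
        distinct′ : ∀ {x y e f s t} → pend′ x ≡ just (e , s) → pend′ y ≡ just (f , t) → x ≢ y → rank′ e ≢ rank′ f
        distinct′ q q′ x≢y with pend′-inv q | pend′-inv q′
        ... | inj₁ z | inj₁ z′ = distinct S₁ z z′ x≢y
        ... | inj₁ z | inj₂ (_ , refl) = apart (unused-pend z)
        ... | inj₂ (_ , refl) | inj₁ z = apart (unused-pend z) ∘ sym
        ... | inj₂ (refl , _) | inj₂ (refl , _) = ⊥-elim (x≢y refl)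
        pendOK′ : ∀ {w e t} → pend′ w ≡ just (e , t) → PendOK i rank′ (side S) w e t
        pendOK′ q with pend′-inv q
        ... | inj₁ z = pendOK S₁ z
        ... | inj₂ (refl , refl) = record
          { notRoot = v≢r ; joins = joins-sym {ends = ends} j ; toward = toward
          ; ready = toward-ready S₁ cp j (toward lo) ; current = ℕ.≤-reflexive cp ; proper = v≢u ∘ sym }
        S₂ : State i rank′ pend′
        S₂ = record { side = side S ; sideOK = sideOK S₁ ; pendOK = pendOK′ ; ordered = ordered S₁
                    ; distinct = distinct′ ; late = late S₁ }
        keep-pend : ∀ {e w t} → pend w ≡ just (e , t) → Done (side S) w ⊎ (∃[ t ] pend′ w ≡ just (e , t))
        keep-pend q = inj₂ (_ , trans (update-other pend {v} _ λ { refl → nothing≢just (trans (sym no-pend) q) }) q)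
          where
          nothing≢just : ∀ {x : Fin m × Fin n} → nothing ≢ just x
          nothing≢just ()
        new : ∀ {e w} → c e ≡ i → IncidentTo ends e w → Done (side S) w ⊎ (∃[ t ] pend′ w ≡ just (e , t))
        new eq inc with refl ← only eq with inc-joins ends inc j
        ... | inj₁ refl = inj₁ done-u
        ... | inj₂ refl = inj₂ (u , update-same pend v _)

      step : ∃₂ λ rank′ pend′ → Boundary (suc i) rank′ pend′
      step with status pend {side S} full v
      ... | inj₁ (inj₁ d) = _ , _ , unchanged (done-p {side S} done-u d)
      ... | inj₁ (inj₂ q) = _ , _ , pending-head q
      ... | inj₂ q        = _ , _ , new-head q

    layer-step : Layer ends r (λ e → c e < i) (λ e → c e ≡ i) (λ e → i < c e) → ∃₂ λ rank′ pend′ → Boundary (suc i) rank′ pend′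
    layer-step (ascending A _)    = let rank′ , B′ = ascend A in rank′ , pend , B′
    -- Each vertex of a down chain is `r` or has degree two in earlier chains, hence is done
    -- already.
    layer-step (descending _ two) = rank , pend , unchanged (λ eq inc → root-or-two (two eq inc))
    layer-step (oneway cp only j tail _) = OneWay.step cp only j (root-or-two tail)

  Layers : ℕ → Set
  Layers K = ∀ i → i < K → Layer ends r (λ e → c e < i) (λ e → c e ≡ i) (λ e → i < c e)

  initial : Boundary 0 (λ _ → 0ℚ) (λ _ → nothing)
  initial = record
    { state = record
      { side = λ _ _ → nothing ; sideOK = λ () ; pendOK = λ ()
      ; ordered = λ { lohi (root _) (root _) → up 0<1 ; hilo (root _) (root _) → down 0<1 }
      ; distinct = λ ()
      ; late = λ { _ _ j (inj₁ (_ , lt , _)) → ℕ.≤-<-trans z≤n lt ; _ _ j (inj₂ (_ , _ , lt , _)) → ℕ.≤-<-trans z≤n lt } }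
    ; full = λ () ; cover = λ () ; usedˢ = λ () ; usedᵖ = λ () }
    where
    0<1 : 0ℚ ℚ.< 1ℚ
    0<1 = toWitness {a? = 0ℚ ℚ.<? 1ℚ} _

  build : ∀ K → Layers K → ∃₂ λ rank pend → Boundary K rank pend
  build zero    _      = _ , _ , initial
  build (suc K) layers with _ , _ , B ← build K (λ i i<K → layers i (ℕ.m≤n⇒m≤1+n i<K)) =
    LayerStep.layer-step B (layers K ℕ.≤-refl)

-- Layers of a chain decomposition

sum-pos : ∀ {A : Set} (f : A → ℕ) xs → 1 ≤ sum (map f xs) → ∃[ x ] x ∈ xs × 1 ≤ f x
sum-pos f (x ∷ xs) p with f x in eq
... | suc _ = x , here refl , subst (1 ≤_) (sym eq) (s≤s z≤n)
... | zero with y , y∈ , q ← sum-pos f xs p = y , there y∈ , q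

sum-two : ∀ {A : Set} (f : A → ℕ) xs → Unique xs → 2 ≤ sum (map f xs) →
          (∃[ x ] 2 ≤ f x) ⊎ (∃[ x ] ∃[ y ] x ≢ y × 1 ≤ f x × 1 ≤ f y)
sum-two f (x ∷ xs) (x∉ ∷ u) p with f x in eq
... | zero        = sum-two f xs u p
... | suc zero with y , y∈ , q ← sum-pos f xs (ℕ.s≤s⁻¹ p) =
  inj₂ (x , y , All.lookup x∉ y∈ , subst (1 ≤_) (sym eq) (s≤s z≤n) , q)
... | suc (suc _) = inj₁ (x , subst (2 ≤_) (sym eq) (s≤s (s≤s z≤n)))

Unique-rotate : ∀ {A : Set} (xs : List A) {ys} → Unique (xs ++ ys) → Unique (ys ++ xs)
Unique-rotate xs u = let ux , uy , disj = Unique-++⁻ xs u in ++⁺ uy ux λ (y∈ , x∈) → disj x∈ y∈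

module _ {n m : ℕ} (ends : Fin m → Fin n × Fin n) where

  endCount-inc : ∀ {e v} → 1 ≤ endCount ends e v → IncidentTo ends e v
  endCount-inc {e} {v} p with proj₁ (ends e) ≟ v | proj₂ (ends e) ≟ v
  ... | yes q | _     = inj₁ q
  ... | no _  | yes q = inj₂ q
  endCount-inc () | no _ | no _

  endCount-loop : ∀ {e v} → 2 ≤ endCount ends e v → ends e ≡ (v , v)
  endCount-loop {e} {v} p with proj₁ (ends e) ≟ v | proj₂ (ends e) ≟ v
  ... | yes refl | yes q = cong (proj₁ (ends e) ,_) q
  endCount-loop (s≤s ()) | yes _ | no _
  endCount-loop (s≤s ()) | no _  | yes _
  endCount-loop () | no _ | no _

  deg-two : ∀ S {v} → 2 ≤ deg ends S v → Two ends (λ e → S e ≡ true) v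
  deg-two S {v} p = Sum.map (λ (e , q) → e , in-S 1 e q , endCount-loop (count 1 e q))
    (λ (e , f , e≢f , q , q′) → e , f , in-S 0 e q , in-S 0 f q′ , e≢f , endCount-inc (count 0 e q) , endCount-inc (count 0 f q′))
    (sum-two _ (allFin m) (allFin⁺ m) p)
    where
    in-S : ∀ k e → suc k ≤ (if S e then endCount ends e v else 0) → S e ≡ true
    in-S k e q with S e
    ... | true = refl
    in-S k e () | false
    count : ∀ k e → suc k ≤ (if S e then endCount ends e v else 0) → suc k ≤ endCount ends e v
    count k e q with S e
    ... | true = q
    count k e () | false

  walk-tabulate : ∀ len (vert : Fin (suc len) → Fin n) (edge : Fin len → Fin m) →
                  (∀ i → Joins ends (edge i) (vert (inject₁ i)) (vert (suc i))) →
                  Walk ends (vert zero) (tabulate λ i → edge i , vert (suc i)) (vert (fromℕ len))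
  walk-tabulate zero      vert edge step = []
  walk-tabulate (suc len) vert edge step = step zero ∷ walk-tabulate len (vert ∘ suc) (edge ∘ suc) (step ∘ suc)

  split-at : ∀ {a ws c y} → Walk ends a ws c → y ∈ verts ends ws →
             ∃₂ λ xs ys → ws ≡ xs ++ ys × Walk ends a xs y × Walk ends y ys c
  split-at (j ∷ w) (here refl) = _ ∷ [] , _ , refl , j ∷ [] , w
  split-at (j ∷ w) (there y∈) with xs , ys , refl , w₁ , w₂ ← split-at w y∈ = _ ∷ xs , ys , refl , j ∷ w₁ , w₂

  -- An edge used at `i` and at `j` has the same ends both times. If they match in order, the
  -- indices agree; if they are swapped, each index would exceed the other.
  path-edge-injective : ∀ {u v} (P : Path ends u v) → Injective _≡_ _≡_ (Path.edge P)
  path-edge-injective P {i} {j} eq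
    with joins-cases {ends = ends} (step i) (subst (λ e → Joins ends e (vert (inject₁ j)) (vert (suc j))) (sym eq) (step j))
    where open Path P
  ... | inj₁ (p , _) = inject₁-injective (Path.vinj P p)
  ... | inj₂ (p , q) = ⊥-elim (ℕ.<-asym (below i j p) (below j i (sym q)))
    where
    below : ∀ i j → Path.vert P (inject₁ i) ≡ Path.vert P (suc j) → toℕ j < toℕ i
    below i j p = ℕ.≤-reflexive (trans (cong toℕ (sym (Path.vinj P p))) (toℕ-inject₁ i))

  module _ (r : Fin n) where

    root-or-two : ∀ {S v} → RootOrDeg2 ends r S v → v ≡ r ⊎ Two ends (λ e → S e ≡ true) v
    root-or-two {S} = Sum.map₂ (deg-two S)

    two-some : ∀ {S v} → v ≡ r ⊎ Two ends S v → v ≡ r ⊎ (∃[ e ] S e × IncidentTo ends e v)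
    two-some = Sum.map₂ λ { (inj₁ (e , s , loop)) → e , s , inj₁ (cong proj₁ loop)
                          ; (inj₂ (e , _ , s , _ , _ , i , _)) → e , s , i }

    ascent : ∀ {H Hb X} → UpChain ends r H Hb X →
             Ascent ends r (λ e → H e ≡ true) X × AllTwo ends r (λ e → Hb e ≡ true) X
    ascent {H} {Hb} {X} (inj₁ (u , v , P , _ , exact , high , startP , finishP)) = record
      { walk    = walk-tabulate len vert edge step
      ; covers  = λ x → let j , eq = Equivalence.to (exact _) x in
                        subst (_∈ _) eq (subst (edge j ∈_) (sym edges≡) (∈-tabulate⁺ j))
      ; within  = λ e∈ → let j , eq = ∈-tabulate⁻ (subst (_ ∈_) edges≡ e∈) in Equivalence.from (exact _) (j , sym eq)
      ; uniqueᵉ = subst Unique (sym edges≡) (tabulate⁺ (path-edge-injective P))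
      ; uniqueᵛ = subst Unique (sym verts≡) (tabulate⁺ (suc-injective ∘ vinj))
      ; start   = subst (λ w → w ≡ r ⊎ InSub ends H w) (sym start) startP
      ; finish  = subst (λ w → w ≡ r ⊎ InSub ends H w) (sym finish) finishP
      ; closing = inj₂ λ a∈ → let j , eq = ∈-tabulate⁻ (subst (_ ∈_) verts≡ a∈) in contradiction (vinj eq) λ ()
      } , two
      where
      open Path P
      steps = tabulate λ i → edge i , vert (suc i)
      edges≡ : edges ends steps ≡ tabulate edge
      edges≡ = map-tabulate _ proj₁
      verts≡ : verts ends steps ≡ tabulate (vert ∘ suc)
      verts≡ = map-tabulate _ proj₂
      two : AllTwo ends r (λ e → Hb e ≡ true) X
      two x inc with j , refl ← Equivalence.to (exact _) x with inc-joins ends inc (step j)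
      ... | inj₁ refl = root-or-two (high _)
      ... | inj₂ refl = root-or-two (high _)
    -- The cycle is a closed walk from `vert zero`, rotated to begin at the vertex that is `r` or
    -- has degree two in `H`.
    ascent {H} {Hb} {X} (inj₂ (C , exact , high , j , low)) = rotated (split-at walk (vert∈ j)) , two
      where
      open Cycle C
      forward = tabulate λ i → edge (inject₁ i) , vert (suc i)
      steps = forward ∷ʳ (edge (fromℕ len) , vert zero)
      walk : Walk ends (vert zero) steps (vert zero)
      walk = walk-++ ends (walk-tabulate len vert (edge ∘ inject₁) step) (close ∷ [])
      edges≡ : edges ends steps ≡ tabulate (edge ∘ inject₁) ∷ʳ edge (fromℕ len)
      edges≡ = trans (map-++ proj₁ forward _) (cong (_∷ʳ _) (map-tabulate _ proj₁))
      verts≡ : verts ends steps ≡ tabulate (vert ∘ suc) ∷ʳ vert zero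
      verts≡ = trans (map-++ proj₂ forward _) (cong (_∷ʳ _) (map-tabulate _ proj₂))
      vert∈ : ∀ i → vert i ∈ verts ends steps
      vert∈ zero    = subst (_ ∈_) (sym verts≡) (∈-++⁺ʳ (tabulate (vert ∘ suc)) (here refl))
      vert∈ (suc i) = subst (_ ∈_) (sym verts≡) (∈-++⁺ˡ (∈-tabulate⁺ i))
      edge∈ : ∀ i → edge i ∈ edges ends steps
      edge∈ i with view i
      ... | ‵fromℕ     = subst (_ ∈_) (sym edges≡) (∈-++⁺ʳ (tabulate (edge ∘ inject₁)) (here refl))
      ... | ‵inject₁ i = subst (_ ∈_) (sym edges≡) (∈-++⁺ˡ (∈-tabulate⁺ i))
      ∈edge : ∀ {e} → e ∈ edges ends steps → ∃[ i ] edge i ≡ e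
      ∈edge e∈ with ∈-++⁻ (tabulate (edge ∘ inject₁)) (subst (_ ∈_) edges≡ e∈)
      ... | inj₁ e∈′         = let i , eq = ∈-tabulate⁻ e∈′ in inject₁ i , sym eq
      ... | inj₂ (here refl) = _ , refl
      uniqueᵉ : Unique (edges ends steps)
      uniqueᵉ = subst Unique (sym edges≡) (++⁺ (tabulate⁺ (inject₁-injective ∘ einj)) ([] ∷ [])
        λ { (e∈ , here refl) → let i , eq = ∈-tabulate⁻ e∈ in fromℕ≢inject₁ (einj eq) })
      uniqueᵛ : Unique (verts ends steps)
      uniqueᵛ = subst Unique (sym verts≡) (++⁺ (tabulate⁺ (suc-injective ∘ vinj)) ([] ∷ [])
        λ { (v∈ , here refl) → let i , eq = ∈-tabulate⁻ v∈ in contradiction (vinj eq) λ () })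
      rotated : (∃₂ λ xs ys → steps ≡ xs ++ ys × Walk ends (vert zero) xs (vert j) × Walk ends (vert j) ys (vert zero)) →
                Ascent ends r (λ e → H e ≡ true) X
      rotated (xs , ys , eq , w₁ , w₂) = record
        { walk    = walk-++ ends w₂ w₁
        ; covers  = λ x → let i , eq′ = Equivalence.to (exact _) x in turn (subst (_∈ _) eq′ (edge∈ i))
        ; within  = λ e∈ → Equivalence.from (exact _) (∈edge (unturn e∈))
        ; uniqueᵉ = unique proj₁ uniqueᵉ
        ; uniqueᵛ = unique proj₂ uniqueᵛ
        ; start   = two-some (root-or-two low)
        ; finish  = two-some (root-or-two low)
        ; closing = inj₁ (root-or-two low) }
        where
        unique : ∀ {A : Set} (f : Fin m × Fin n → A) → Unique (map f steps) → Unique (map f (ys ++ xs))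
        unique f u = subst Unique (sym (map-++ f ys xs))
          (Unique-rotate (map f xs) (subst Unique (trans (cong (map f) eq) (map-++ f xs ys)) u))
        turn : ∀ {e} → e ∈ edges ends steps → e ∈ edges ends (ys ++ xs)
        turn e∈ = subst (_ ∈_) (sym (map-++ proj₁ ys xs)) (Sum.[ ∈-++⁺ʳ (edges ends ys) , ∈-++⁺ˡ ]
          (∈-++⁻ (edges ends xs) (subst (_ ∈_) (trans (cong (map proj₁) eq) (map-++ proj₁ xs ys)) e∈)))
        unturn : ∀ {e} → e ∈ edges ends (ys ++ xs) → e ∈ edges ends steps
        unturn e∈ = subst (_ ∈_) (sym (trans (cong (map proj₁) eq) (map-++ proj₁ xs ys)))
          (Sum.[ ∈-++⁺ʳ (edges ends xs) , ∈-++⁺ˡ ] (∈-++⁻ (edges ends ys) (subst (_ ∈_) (map-++ proj₁ ys xs) e∈)))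
      two : AllTwo ends r (λ e → Hb e ≡ true) X
      two x inc with i , refl ← Equivalence.to (exact _) x with view i
      ... | ‵fromℕ = Sum.[ (λ { refl → root-or-two (high _) }) , (λ { refl → root-or-two (high _) }) ] (inc-joins ends inc close)
      ... | ‵inject₁ i = Sum.[ (λ { refl → root-or-two (high _) }) , (λ { refl → root-or-two (high _) }) ] (inc-joins ends inc (step i))

    ascent-map : ∀ {H H′ X X′ : Fin m → Set} → (∀ {e} → H e → H′ e) → (∀ {e} → X e → X′ e) → (∀ {e} → X′ e → X e) →
                 Ascent ends r H X → Ascent ends r H′ X′
    ascent-map f g g′ A = record
      { walk = walk ; covers = covers ∘ g′ ; within = g ∘ within ; uniqueᵉ = uniqueᵉ ; uniqueᵛ = uniqueᵛ
      ; start = Sum.map₂ (λ (e , h , i) → e , f h , i) start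
      ; finish = Sum.map₂ (λ (e , h , i) → e , f h , i) finish
      ; closing = Sum.map₁ (Sum.map₂ (Two-mono ends f)) closing }
      where open Ascent A

    layer-map : ∀ {H H′ X X′ Hb Hb′ : Fin m → Set} → (∀ {e} → H e → H′ e) → (∀ {e} → X e → X′ e) → (∀ {e} → X′ e → X e) →
                (∀ {e} → Hb e → Hb′ e) → Layer ends r H X Hb → Layer ends r H′ X′ Hb′
    layer-map f g g′ h (ascending A two)  = ascending (ascent-map f g g′ A) λ x i → Sum.map₂ (Two-mono ends h) (two (g′ x) i)
    layer-map f g g′ h (descending A two) = descending (ascent-map h g g′ A) λ x i → Sum.map₂ (Two-mono ends f) (two (g′ x) i)
    layer-map f g g′ h (oneway x only j tail head) =
      oneway (g x) (only ∘ g′) j (Sum.map₂ (Two-mono ends f) tail) (Sum.map₂ (Two-mono ends h) head)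

    layer-flip : ∀ {H X Hb : Fin m → Set} → Layer ends r H X Hb → Layer ends r Hb X H
    layer-flip (ascending A two)           = descending A two
    layer-flip (descending A two)          = ascending A two
    layer-flip (oneway x only j tail head) = oneway x only (joins-sym {ends = ends} j) head tail

    layer-two : ∀ {H X Hb : Fin m → Set} {e v} → Layer ends r H X Hb → X e → IncidentTo ends e v →
                v ≡ r ⊎ Two ends H v ⊎ Two ends Hb v
    layer-two (ascending _ two)  x i = Sum.map₂ inj₂ (two x i)
    layer-two (descending _ two) x i = Sum.map₂ inj₁ (two x i)
    layer-two (oneway _ only j tail head) x i with refl ← only x with inc-joins ends i j
    ... | inj₁ refl = Sum.map₂ inj₁ tail
    ... | inj₂ refl = Sum.map₂ inj₂ head

    module _ (D : ChainDecomposition ends r) where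
      open ChainDecomposition D

      layer : ∀ i → Layer ends r (λ e → toℕ (c e) < toℕ i) (λ e → toℕ (c e) ≡ toℕ i) (λ e → toℕ i < toℕ (c e))
      layer i = layer-map (ℕ.<ᵇ⇒< _ _ ∘ Equivalence.from T-≡) (cong toℕ) toℕ-injective (ℕ.<ᵇ⇒< _ _ ∘ Equivalence.from T-≡) raw
        where
        raw : Layer ends r (λ e → Hlow i e ≡ true) (Gi i) (λ e → Hhigh i e ≡ true)
        raw with isChain i
        ... | inj₁ chain        = let A , two = ascent chain in ascending A two
        ... | inj₂ (inj₁ chain) = let A , two = ascent chain in descending A two
        ... | inj₂ (inj₂ (e , u , v , exact , j , tail , head)) =
          oneway (Equivalence.from (exact e) refl) (λ {f} → Equivalence.to (exact f)) j (root-or-two tail) (root-or-two head)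

      index : Fin m → ℕ
      index e = toℕ (c e)

      index′ : Fin m → ℕ
      index′ e = k ℕ.∸ toℕ (c e)

      layers : Build.Layers ends r index (suc k)
      layers i i<K = subst (λ i → Layer ends r (λ e → index e < i) (λ e → index e ≡ i) (λ e → i < index e))
                           (toℕ-fromℕ< i<K) (layer (fromℕ< i<K))

      index≤k : ∀ e → index e ≤ k
      index≤k e = ℕ.s≤s⁻¹ (toℕ<n (c e))

      -- Reversal exchanges earlier and later chains, so up chains become down chains and one-way
      -- chains swap tail and head.
      layers′ : Build.Layers ends r index′ (suc k)
      layers′ i i<K = layer-map
        (λ {e} lt → subst (index′ e <_) i≡ (ℕ.∸-monoʳ-< lt (index≤k e)))
        (λ eq → trans (cong (k ℕ.∸_) eq) i≡)
        (λ {e} eq → trans (sym (ℕ.m∸[m∸n]≡n (index≤k e))) (cong (k ℕ.∸_) eq))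
        (λ {e} lt → subst (_< index′ e) i≡ (ℕ.∸-monoʳ-< lt (ℕ.m∸n≤m k i)))
        (layer-flip (layers (k ℕ.∸ i) (s≤s (ℕ.m∸n≤m k i))))
        where
        i≡ : k ℕ.∸ (k ℕ.∸ i) ≡ i
        i≡ = ℕ.m∸[m∸n]≡n (ℕ.s≤s⁻¹ i<K)

<σ-trans : ∀ {σ a b c} → a <[ σ ] b → b <[ σ ] c → a <[ σ ] c
<σ-trans (up p)   (up q)   = up (ℚ.<-trans p q)
<σ-trans (down p) (down q) = down (ℚ.<-trans q p)

-- The four trees

module Pair {n m : ℕ} (ends : Fin m → Fin n × Fin n) (r : Fin n) (c : Fin m → ℕ) {K : ℕ}
            (layers : Build.Layers ends r c K) (early : ∀ v → v ≢ r → Build.Early ends r c K v) where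
  open Build ends r c

  built : ∃₂ λ rank pend → Boundary K rank pend
  built = build K layers

  rank : Fin m → ℚ
  rank = proj₁ built

  open Boundary (proj₂ (proj₂ built))

  parent : Sides n m
  parent = side state

  module OK {σ v e u} (p : parent σ v ≡ just (e , u)) = SideOK (sideOK state p)

  -- By `parented` the default is taken only at `r`. Comparing these values gives the order required
  -- by `Tree`.
  value : Side → Fin n → ℚ
  value σ v = maybe′ (rank ∘ proj₁) (sentinel σ) (parent σ v)

  value-root : ∀ σ → parent σ r ≡ nothing
  value-root σ with parent σ r in eq
  ... | nothing = refl
  ... | just _  = ⊥-elim (OK.notRoot eq refl)

  at-value : ∀ {σ v q} → At rank parent σ v q → q ≡ value σ v
  at-value {σ} (root refl) rewrite value-root σ = refl
  at-value (set p) rewrite p = refl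

  parented : ∀ σ v → v ≢ r → ∃[ x ] parent σ v ≡ just x
  parented σ v v≢r with early-done state cover (early v v≢r) σ
  ... | inj₁ v≡r = ⊥-elim (v≢r v≡r)
  ... | inj₂ p   = p

  descends : ∀ {σ v e u} → parent σ v ≡ just (e , u) → value σ u <[ σ ] value σ v
  descends {σ} p with q , at , lt ← OK.toward p = subst₂ _<[ σ ]_ (at-value at) (at-value (set p)) lt

  order : ∀ σ → IsStrictPartialOrder _≡_ (λ u v → value σ u <[ σ ] value σ v)
  order σ = record
    { isEquivalence = isEquivalence ; irrefl = λ { refl → <σ-irrefl refl } ; trans = <σ-trans
    ; <-resp-≈ = (λ { refl → id }) , λ { refl → id } }

  module TreeOf (σ : Side) = Tree ends r (parent σ) (λ u v → value σ u <[ σ ] value σ v) (order σ)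
                                  (value-root σ) (parented σ) OK.joins descends
  open TreeOf public using (tree; spanning; Ancestral; path-ancestral)

  not-root : ∀ {σ v e} → Ancestral σ v e → v ≢ r
  not-root (TreeOf.here p)    = OK.notRoot p
  not-root (TreeOf.there p _) = OK.notRoot p

  ancestral-value : ∀ {σ v e} → Ancestral σ v e → rank e ≡ value σ v ⊎ rank e <[ σ ] value σ v
  ancestral-value (TreeOf.here p) = inj₁ (at-value (set p))
  ancestral-value {σ} (TreeOf.there p a) with ancestral-value a
  ... | inj₁ eq = inj₂ (subst (_<[ σ ] _) (sym eq) (descends p))
  ... | inj₂ lt = inj₂ (<σ-trans lt (descends p))

  -- `timely` bounds the first edge by `j`, and `ready` then gives the parent degree two below `j`
  -- as well, so the bound travels up to `r`.
  ancestral-early : ∀ {σ v e} → Ancestral σ v e → ∀ {j} → Early j v → c e < j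
  ancestral-early (TreeOf.here p) t = OK.timely p _ t
  ancestral-early (TreeOf.there p a) t with OK.ready p
  ... | inj₁ u≡r = ⊥-elim (not-root a u≡r)
  ... | inj₂ t′  = ancestral-early a (Early-mono (OK.timely p _ t) t′)

  disjoint : ∀ {σ τ v e} → Opp σ τ → Ancestral σ v e → ¬ Ancestral τ v e
  disjoint {σ} {τ} {v} {e} o a b =
    Sum.[ (λ eq → <σ-irrefl eq below) , (λ lt → <σ-irrefl refl (<σ-trans below (<-flip (opp-sym o) lt))) ] (ancestral-value b)
    where
    separated : value σ v <[ σ ] value τ v
    separated =
      let _ , p = parented σ v (not-root a)
          _ , q = parented τ v (not-root a)
      in subst₂ _<[ σ ]_ (at-value (set p)) (at-value (set q)) (ordered state o (set p) (set q))
    below : rank e <[ σ ] value τ v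
    below = Sum.[ (λ eq → subst (_<[ σ ] _) (sym eq) separated) , (λ lt → <σ-trans lt separated) ] (ancestral-value a)

-- The chain that separates the two directions at a vertex

module Separation {n m : ℕ} (ends : Fin m → Fin n × Fin n) (r : Fin n) (c : Fin m → ℕ) {K : ℕ}
                  (layers : Build.Layers ends r c K) (c<K : ∀ e → c e < K) where
  open Build ends r c

  Early? : ∀ j v → Dec (Early j v)
  Early? j v =
    (any? λ e → (c e ℕ.<? j) ×-dec Prod.≡-dec _≟_ _≟_ (ends e) (v , v)) ⊎-dec
    (any? λ e → any? λ f → (c e ℕ.<? j) ×-dec (c f ℕ.<? j) ×-dec ¬? (e ≟ f) ×-dec inc? e ×-dec inc? f)
    where
    inc? : ∀ e → Dec (IncidentTo ends e v)
    inc? e = (proj₁ (ends e) ≟ v) ⊎-dec (proj₂ (ends e) ≟ v)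

  crossing : ∀ {v} j → j ≤ K → Early j v → ∃[ i ] i < K × ¬ Early i v × Early (suc i) v
  crossing zero _ (inj₁ (_ , () , _))
  crossing zero _ (inj₂ (_ , _ , () , _))
  crossing {v} (suc j) j<K t with Early? j v
  ... | yes t′ = crossing j (ℕ.<⇒≤ j<K) t′
  ... | no ¬t  = j , j<K , ¬t , t

  crossing-edge : ∀ {i v} → ¬ Early i v → Early (suc i) v → ∃[ e ] c e ≡ i × IncidentTo ends e v
  crossing-edge ¬t (inj₁ (e , lt , loop)) with ℕ.m<1+n⇒m<n∨m≡n lt
  ... | inj₂ eq  = e , eq , inj₁ (cong proj₁ loop)
  ... | inj₁ lt′ = ⊥-elim (¬t (inj₁ (e , lt′ , loop)))
  crossing-edge ¬t (inj₂ (e , f , lt , lt′ , ne , i , i′)) with ℕ.m<1+n⇒m<n∨m≡n lt | ℕ.m<1+n⇒m<n∨m≡n lt′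
  ... | inj₂ eq | _       = e , eq , i
  ... | _       | inj₂ eq = f , eq , i′
  ... | inj₁ l  | inj₁ l′ = ⊥-elim (¬t (inj₂ (e , f , l , l′ , ne , i , i′)))

  -- Some edge lies at `v`, and its chain forces degree two at `v` in the earlier or in the later
  -- chains.
  early : NoIsolatedVertices ends → ∀ v → v ≢ r → Early K v
  early conn v v≢r with e , inc ← conn v with layer-two ends r (layers (c e) (c<K e)) refl inc
  ... | inj₁ v≡r        = ⊥-elim (v≢r v≡r)
  ... | inj₂ (inj₁ low)  = Early-mono (ℕ.<⇒≤ (c<K e)) low
  ... | inj₂ (inj₂ high) = Two-mono ends (λ {f} _ → c<K f) high

  -- Take the chain `i` that brings `v` to degree two. It has an edge at `v`, so `v` has degree two
  -- before or after it; before is excluded by the choice of `i`.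
  separate : ∀ {v} → v ≢ r → Early K v → ∃[ i ] Early (suc i) v × Two ends (λ e → i < c e) v
  separate v≢r t with i , i<K , ¬t , t′ ← crossing K ℕ.≤-refl t
    with e , eq , inc ← crossing-edge ¬t t′
    with layer-two ends r (layers i i<K) eq inc
  ... | inj₁ v≡r        = ⊥-elim (v≢r v≡r)
  ... | inj₂ (inj₁ low)  = ⊥-elim (¬t low)
  ... | inj₂ (inj₂ high) = i , t′ , high

module FourTrees {n m : ℕ} (ends : Fin m → Fin n × Fin n) (r : Fin n)
                 (conn : NoIsolatedVertices ends) (D : ChainDecomposition ends r) where
  open ChainDecomposition D using (k)

  index< : ∀ e → index ends r D e < suc k
  index< e = s≤s (index≤k ends r D e)

  index′< : ∀ e → index′ ends r D e < suc k
  index′< e = s≤s (ℕ.m∸n≤m k (index ends r D e))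

  module SepF = Separation ends r (index ends r D) (layers ends r D) index<
  module SepB = Separation ends r (index′ ends r D) (layers′ ends r D) index′<
  module F = Pair ends r (index ends r D) (layers ends r D) (SepF.early conn)
  module B = Pair ends r (index′ ends r D) (layers′ ends r D) (SepB.early conn)

  cross : ∀ {σ τ v e} → F.Ancestral σ v e → ¬ B.Ancestral τ v e
  cross {v = v} {e} a b =
    let v≢r = F.not-root a
        i , low , high = SepF.separate v≢r (SepF.early conn v v≢r)
        c≤i = ℕ.s≤s⁻¹ (F.ancestral-early a low)
        -- In the reversed numbering the chains after `i` are those of index below `k ∸ i`, so
        -- `high` says that `v` is `Early` there.
        c′< = B.ancestral-early b {k ℕ.∸ i} (Two-mono ends (λ {f} lt → ℕ.∸-monoʳ-< lt (index≤k ends r D f)) high)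
    in ℕ.<⇒≱ c′< (ℕ.∸-monoʳ-≤ k c≤i)

  trees : Fin 4 → Fin m → Bool
  trees zero                   = F.tree lo
  trees (suc zero)             = F.tree hi
  trees (suc (suc zero))       = B.tree lo
  trees (suc (suc (suc zero))) = B.tree hi

  Ancestral : Fin 4 → Fin n → Fin m → Set
  Ancestral zero                   = F.Ancestral lo
  Ancestral (suc zero)             = F.Ancestral hi
  Ancestral (suc (suc zero))       = B.Ancestral lo
  Ancestral (suc (suc (suc zero))) = B.Ancestral hi

  trees-spanning : ∀ i → SpanningTree ends r (trees i)
  trees-spanning zero                   = F.spanning lo
  trees-spanning (suc zero)             = F.spanning hi
  trees-spanning (suc (suc zero))       = B.spanning lo
  trees-spanning (suc (suc (suc zero))) = B.spanning hi

  ancestral : ∀ i {v} (P : Path ends r v) → (∀ j → trees i (Path.edge P j) ≡ true) → ∀ j → Ancestral i v (Path.edge P j)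
  ancestral zero                   = F.path-ancestral lo
  ancestral (suc zero)             = F.path-ancestral hi
  ancestral (suc (suc zero))       = B.path-ancestral lo
  ancestral (suc (suc (suc zero))) = B.path-ancestral hi

  disjoint : ∀ i j → i ≢ j → ∀ {v e} → Ancestral i v e → ¬ Ancestral j v e
  disjoint zero                   zero                   i≢j _ _ = i≢j refl
  disjoint zero                   (suc zero)             _ a b = F.disjoint lohi a b
  disjoint zero                   (suc (suc zero))       _ a b = cross a b
  disjoint zero                   (suc (suc (suc zero))) _ a b = cross a b
  disjoint (suc zero)             zero                   _ a b = F.disjoint hilo a b
  disjoint (suc zero)             (suc zero)             i≢j _ _ = i≢j refl
  disjoint (suc zero)             (suc (suc zero))       _ a b = cross a b
  disjoint (suc zero)             (suc (suc (suc zero))) _ a b = cross a b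
  disjoint (suc (suc zero))       zero                   _ a b = cross b a
  disjoint (suc (suc zero))       (suc zero)             _ a b = cross b a
  disjoint (suc (suc zero))       (suc (suc zero))       i≢j _ _ = i≢j refl
  disjoint (suc (suc zero))       (suc (suc (suc zero))) _ a b = B.disjoint lohi a b
  disjoint (suc (suc (suc zero))) zero                   _ a b = cross b a
  disjoint (suc (suc (suc zero))) (suc zero)             _ a b = cross b a
  disjoint (suc (suc (suc zero))) (suc (suc zero))       _ a b = B.disjoint hilo a b
  disjoint (suc (suc (suc zero))) (suc (suc (suc zero))) i≢j _ _ = i≢j refl

theorem4 : ∀ (n m : ℕ) (ends : Fin m → Fin n × Fin n) (r : Fin n)
    → NoIsolatedVertices ends
    → ChainDecomposition ends r
    → Σ[ T ∈ (Fin 4 → Fin m → Bool) ]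
    ((∀ i → SpanningTree ends r (T i))
    × (∀ i j → i ≢ j → EdgeIndependent ends r (T i) (T j)))
theorem4 n m ends r conn D = trees , trees-spanning ,
  λ i j i≢j v P Q inP inQ a b same →
    disjoint i j i≢j (ancestral i P inP a) (subst (Ancestral j v) (sym same) (ancestral j Q inQ b))
  where open FourTrees ends r conn D
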